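{- Let $G$ be a connected graph with $n$ vertices and let $\rho$ be an integer with $\mathrm{tb}(G)\leq \rho$. Then $G$ admits an additive $(2\rho\log_2 n)$-spanner with at most $n\log_2 n$ edges. Furthermore, such a sparse additive spanner of $G$ can be constructed in polynomial time.
   Context: All graphs are finite, connected, unweighted, undirected, without loops or multiple edges; $d_G(u,v)$ is the number of edges of a shortest $u$–$v$ path in $G$, and $D_r(v,G)=\{u: d_G(u,v)\le r\}$ is the disk of radius $r$ centered at $v$. A tree-decomposition of $G=(V,E)$ is a pair $(\{X_i\mid i\in I\},T=(I,F))$ with $T$ a tree and bags $X_i\subseteq V$ such that (1) $\bigcup_i X_i=V$; (2) every edge $uv\in E$ lies in some bag; (3) for each $v\in V$ the nodes $i$ with $v\in X_i$ induce a connected subtree of $T$. The breadth of a tree-decomposition is the minimum integer $r$ such that for every $i\in I$ there is a vertex $v_i\in V$ (not necessarily in $X_i$) with $X_i\subseteq D_r(v_i,G)$. The tree-breadth $\mathrm{tb}(G)$ is the minimum breadth over all tree-decompositions of $G$. A spanning subgraph $H$ of $G$ is an additive $r$-spanner of $G$ if $d_H(u,v)\le d_G(u,v)+r$ for all $u,v\in V$. -}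

module Defs where

open import Data.Bool.Base using (Bool; true; false; T; _∧_)
open import Data.Fin.Base using (Fin; toℕ)
open import Data.Fin.Subset using (Subset; _∈_)
open import Data.List.Base
  using (List; []; _∷_; length; tabulate; allFin; cartesianProduct; filterᵇ)
open import Data.List.Relation.Unary.All using (All)
open import Data.List.Relation.Unary.Unique.Propositional using (Unique)
open import Data.Nat.Base using (ℕ; zero; suc; _+_; _*_; _^_; _≤_; _<ᵇ_)
open import Data.Nat.Logarithm using (⌊log₂_⌋)
open import Data.Product.Base using (∃-syntax; _×_; _,_; uncurry)
open import Relation.Binary.Construct.Closure.ReflexiveTransitive
  using (Star; ε; _◅_)
open import Relation.Binary.PropositionalEquality.Core using (_≡_)
open import Relation.Nullary.Negation.Core using (¬_)

Minimum : (ℕ → Set) → ℕ → Set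
Minimum P k = P k × (∀ j → P j → k ≤ j)

------------------------------------------------------------------------
-- Graphs

record Graph (n : ℕ) : Set where
  field
    adj    : Fin n → Fin n → Bool
    sym    : ∀ u v → adj u v ≡ adj v u
    irrefl : ∀ u → adj u u ≡ false

open Graph public using (adj)

Adj : ∀ {n} → Graph n → Fin n → Fin n → Set
Adj G u v = T (adj G u v)

Walk : ∀ {n} → Graph n → Fin n → Fin n → Set
Walk G = Star (Adj G)

module _ {n} {R : Fin n → Fin n → Set} where

  vertices : ∀ {u v} → Star R u v → List (Fin n)
  vertices {u} ε       = u ∷ []
  vertices {u} (_ ◅ w) = u ∷ vertices w

  ∣_∣ʷ : ∀ {u v} → Star R u v → ℕ
  ∣ ε ∣ʷ     = 0
  ∣ _ ◅ w ∣ʷ = suc ∣ w ∣ʷ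

record Path {n} (G : Graph n) (u v : Fin n) : Set where
  field
    walk     : Walk G u v
    distinct : Unique (vertices walk)

open Path public using (walk)

Connected : ∀ {n} → Graph n → Set
Connected G = ∀ u v → Path G u v

-- The subgraph induced by S is connected.
ConnectedOn : ∀ {n} → Graph n → (Fin n → Set) → Set
ConnectedOn G S =
  ∀ u v → S u → S v → ∃[ p ] All S (vertices (walk {G = G} {u} {v} p))

-- A cycle is a path with at least two edges together with an edge joining
-- its ends.
Acyclic : ∀ {n} → Graph n → Set
Acyclic G =
  ∀ u v (p : Path G u v) → 2 ≤ ∣ walk p ∣ʷ → ¬ Adj G v u

IsTree : ∀ {n} → Graph n → Set
IsTree G = Connected G × Acyclic G

-- d_G(u,v) = d, as a relation.
Distance : ∀ {n} → Graph n → Fin n → Fin n → ℕ → Set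
Distance G u v = Minimum λ d → ∃[ p ] ∣ walk {G = G} {u} {v} p ∣ʷ ≡ d

Disk : ∀ {n} → ℕ → Fin n → Graph n → Fin n → Set
Disk r v G u = ∃[ d ] Distance G u v d × d ≤ r

edges : ∀ {n} → Graph n → List (Fin n × Fin n)
edges {n} H = filterᵇ (uncurry λ u v → (toℕ u <ᵇ toℕ v) ∧ adj H u v)
                      (cartesianProduct (allFin n) (allFin n))

------------------------------------------------------------------------
-- Tree-breadth

record TreeDecomposition {n} (G : Graph n) : Set where
  field
    {nodes}     : ℕ
    tree        : Graph nodes
    isTree      : IsTree tree
    bag         : Fin nodes → Subset n
    coversVerts : ∀ v → ∃[ i ] v ∈ bag i
    coversEdges : ∀ u v → Adj G u v → ∃[ i ] u ∈ bag i × v ∈ bag i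
    subtrees    : ∀ v → ConnectedOn tree (λ i → v ∈ bag i)

Breadth : ∀ {n} {G : Graph n} → TreeDecomposition G → ℕ → Set
Breadth {G = G} D =
  Minimum λ r → ∀ i → ∃[ v ] (∀ u → u ∈ bag i → Disk r v G u)
  where open TreeDecomposition D

-- tb(G) = k, as a relation.
TreeBreadth : ∀ {n} → Graph n → ℕ → Set
TreeBreadth G = Minimum λ b → ∃[ D ] Breadth {G = G} D b

------------------------------------------------------------------------
-- Spanners

SpanningSubgraph : ∀ {n} → Graph n → Graph n → Set
SpanningSubgraph H G = ∀ u v → Adj H u v → Adj G u v

-- The distance in H is asserted to exist, i.e. to be finite.
AdditiveSpanner : ∀ {n} → ℕ → Graph n → Graph n → Set
AdditiveSpanner r G H =
  SpanningSubgraph H G ×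
  (∀ u v d → Distance G u v d → ∃[ d′ ] Distance H u v d′ × d′ ≤ d + r)

-- The floor of the real number k · log₂ n = log₂ (n ^ k), for n ≥ 1.  It is
-- only used as an upper bound for integers, where the floor loses nothing.
-- Note that this is not k · ⌊log₂ n⌋.
⌊_·log₂_⌋ : ℕ → ℕ → ℕ
⌊ k ·log₂ n ⌋ = ⌊log₂ (n ^ k) ⌋

SparseSpanner : ∀ {n} → ℕ → Graph n → Graph n → Set
SparseSpanner {n} ρ G H =
  AdditiveSpanner ⌊ (2 * ρ) ·log₂ n ⌋ G H ×
  length (edges H) ≤ ⌊ n ·log₂ n ⌋

------------------------------------------------------------------------
-- A model of computation
--
-- A Turing-complete while-language over Booleans, unary numerals, pairs and
-- lists.  Every step is a bounded number of pointer operations (values are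
-- immutable and can be shared; numerals are only inspected by case analysis
-- and there is no built-in equality test or arithmetic), so a run of t steps
-- can be simulated by a Turing machine in time polynomial in t and the size
-- of the input and the output.  Conversely, a pair of lists is a tape, so
-- Turing machines are simulated with constant overhead per step.  Hence
-- polynomially many steps here means polynomial time in the usual sense.

infixr 7 _⊗_
infixr 5 _⨾_
infix  4 _·_⇓_#_

data Type : Set where
  bool nat : Type
  _⊗_      : Type → Type → Type
  list     : Type → Type

⟦_⟧ : Type → Set
⟦ bool ⟧   = Bool
⟦ nat ⟧    = ℕ
⟦ α ⊗ β ⟧  = ⟦ α ⟧ × ⟦ β ⟧
⟦ list α ⟧ = List ⟦ α ⟧

private variable
  α β γ : Type

data Program : Type → Type → Set where
  skip     : Program α α
  _⨾_      : Program α β → Program β γ → Program α γ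
  ⟨_,_⟩    : Program α β → Program α γ → Program α (β ⊗ γ)
  fst      : Program (α ⊗ β) α
  snd      : Program (α ⊗ β) β
  tt ff    : Program α bool
  ifte     : Program α bool → Program α β → Program α β → Program α β
  ze       : Program α nat
  su       : Program nat nat
  caseNat  : Program α β → Program (nat ⊗ α) β → Program (nat ⊗ α) β
  nil      : Program α (list β)
  cons     : Program (α ⊗ list α) (list α)
  caseList : Program γ β → Program ((α ⊗ list α) ⊗ γ) β →
             Program (list α ⊗ γ) β
  while    : Program α bool → Program α α → Program α α

-- p · x ⇓ y # t : on input x, p halts with output y after t steps.
data _·_⇓_#_ : Program α β → ⟦ α ⟧ → ⟦ β ⟧ → ℕ → Set where

  skip : ∀ {x} → skip {α} · x ⇓ x # 1

  seq : ∀ {p : Program α β} {q : Program β γ} {x y z s t} →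
        p · x ⇓ y # s → q · y ⇓ z # t → p ⨾ q · x ⇓ z # suc (s + t)

  pair : ∀ {p : Program α β} {q : Program α γ} {x y z s t} →
         p · x ⇓ y # s → q · x ⇓ z # t →
         ⟨ p , q ⟩ · x ⇓ (y , z) # suc (s + t)

  fst : ∀ {x y} → fst {α} {β} · (x , y) ⇓ x # 1
  snd : ∀ {x y} → snd {α} {β} · (x , y) ⇓ y # 1

  tt : ∀ {x} → tt {α} · x ⇓ true  # 1
  ff : ∀ {x} → ff {α} · x ⇓ false # 1

  if-true  : ∀ {b} {p q : Program α β} {x y s t} →
             b · x ⇓ true # s → p · x ⇓ y # t →
             ifte b p q · x ⇓ y # suc (s + t)
  if-false : ∀ {b} {p q : Program α β} {x y s t} →
             b · x ⇓ false # s → q · x ⇓ y # t →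
             ifte b p q · x ⇓ y # suc (s + t)

  ze : ∀ {x} → ze {α} · x ⇓ zero # 1
  su : ∀ {m} → su · m ⇓ suc m # 1

  case-zero : ∀ {p : Program α β} {q x y t} →
              p · x ⇓ y # t → caseNat p q · (zero , x) ⇓ y # suc t
  case-suc  : ∀ {p : Program α β} {q m x y t} →
              q · (m , x) ⇓ y # t → caseNat p q · (suc m , x) ⇓ y # suc t

  nil  : ∀ {x} → nil {α} {β} · x ⇓ [] # 1
  cons : ∀ {x xs} → cons {α} · (x , xs) ⇓ x ∷ xs # 1

  case-[] : ∀ {p : Program γ β} {q : Program ((α ⊗ list α) ⊗ γ) β} {z y t} →
            p · z ⇓ y # t → caseList p q · ([] , z) ⇓ y # suc t
  case-∷  : ∀ {p : Program γ β} {q : Program ((α ⊗ list α) ⊗ γ) β}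
            {x xs z y t} →
            q · ((x , xs) , z) ⇓ y # t →
            caseList p q · (x ∷ xs , z) ⇓ y # suc t

  while-false : ∀ {b} {p : Program α α} {x s} →
                b · x ⇓ false # s → while b p · x ⇓ x # suc s
  while-true  : ∀ {b} {p : Program α α} {x y z s t u} →
                b · x ⇓ true # s → p · x ⇓ y # t → while b p · y ⇓ z # u →
                while b p · x ⇓ z # suc (s + t + u)

matrix : Type
matrix = list (list bool)

adjacencyMatrix : ∀ {n} → Graph n → ⟦ matrix ⟧
adjacencyMatrix G = tabulate λ u → tabulate λ v → adj G u v

{-# OPTIONS --safe #-}

-- Call a disk of radius r balanced for a connected vertex set C if every
-- component of what it leaves of C has at most |C|/2 vertices.  Some bag of a
-- tree-decomposition separates C evenly: otherwise every node of the tree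
-- points to the side of a component containing more than half of C, two
-- adjacent nodes point at each other, and their two components are disjoint
-- yet both too large.  Hence there is a balanced disk of radius at most ρ.
--
-- Starting from the whole graph, remove from every component C a balanced
-- disk of least radius, and add for each vertex of C the first edge of a
-- shortest path in G to the centre of that disk.  A level costs at most n
-- edges, and after ⌊log₂ n⌋ levels all components are single vertices, which
-- choose no edge.  If a path from a to b survives until level j and meets a
-- disk with centre v there, follow the chosen edges from a and from b towards
-- v until v is reached or the level is left.  The two end points are joined
-- by a walk through v which was already cut at an earlier level, so that
-- induction on j gives the additive error 2ρ per level.
module Submission where

open import Defs
open import Data.Bool.Base using (Bool; true; false; T; _∧_; _∨_; not; if_then_else_)
open import Data.Bool.Properties using (T-∧; T-∨; T-≡; T?; if-float; ∨-comm)
open import Data.Empty using (⊥; ⊥-elim)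
open import Data.Fin.Base using (Fin; zero; suc; toℕ; fromℕ<; combine)
open import Data.Fin.Properties using (_≟_; any?; injective⇒≤; combine-injective; toℕ-fromℕ<)
import Data.Fin.Subset as Subset
open import Data.List.Base
  using (List; []; _∷_; length; lookup; tabulate; allFin; map; reverse; _ʳ++_; foldr; cartesianProduct)
open import Data.List.Membership.Propositional using (_∈_; _∉_)
import Data.List.Membership.DecPropositional as DecMembership
open import Data.List.Membership.Propositional.Properties using (∈-allFin; ∈-lookup; ∈-filter⁻)
open import Data.List.Properties
  using (map-tabulate; length-tabulate; tabulate-cong; reverse-map; length-map; length-reverse;
    reverse-involutive; map-id)
open import Data.List.Relation.Unary.All as All using (All; []; _∷_)
open import Data.List.Relation.Unary.All.Properties using (¬Any⇒All¬; All¬⇒¬Any)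
open import Data.List.Relation.Unary.AllPairs using ([]; _∷_)
open import Data.List.Relation.Unary.Any using (here; there)
open import Data.List.Relation.Unary.Unique.Propositional using (Unique)
open import Data.List.Relation.Unary.Unique.Propositional.Properties
  using (allFin⁺; cartesianProduct⁺; filter⁺)
open import Data.Nat.Base
  using (ℕ; zero; suc; pred; _+_; _*_; _∸_; _^_; _≤_; _<_; z≤n; s≤s; _<ᵇ_; NonZero; ≢-nonZero⁻¹)
open import Data.Nat.Logarithm using (⌊log₂_⌋; ⌊log₂⌋-mono-≤; ⌊log₂[2^n]⌋≡n)
open import Data.Nat.Properties hiding (_≟_)
open import Data.Nat.Solver using (module +-*-Solver)
open import Data.Product.Base using (Σ; _×_; _,_; proj₁; proj₂; ∃-syntax; uncurry)
open import Data.Sum.Base using (_⊎_; inj₁; inj₂) renaming (map₂ to map₂ˢ)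
import Data.Vec.Base as Vec
open import Data.Vec.Properties using ([]=⇒lookup; lookup⇒[]=; lookup∘tabulate)
  renaming (tabulate-cong to tabulateᵛ-cong)
open import Function.Base using (_∘_; id)
open import Function.Bundles using (Equivalence)
open import Relation.Binary.Construct.Closure.ReflexiveTransitive
  using (Star; ε; _◅_; _◅◅_; gmap) renaming (reverse to reverseStar)
open import Relation.Binary.PropositionalEquality
open import Relation.Nullary.Decidable.Core using (Dec; does; yes; no)
open import Relation.Nullary.Negation.Core using (¬_; contradiction)

open Equivalence using (to; from)

-- Polynomially bounded running times

infixl 6 _⊕_
infixl 7 _⊛_

-- Syntax rather than functions: bounds are composed along with the programs, and a bound of the
-- form `c * n ^ k` is extracted once, by recursion.
data Polynomial : Set where
  con     : ℕ → Polynomial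
  var     : Polynomial
  _⊕_ _⊛_ : Polynomial → Polynomial → Polynomial

eval : Polynomial → ℕ → ℕ
eval (con c) n = c
eval var n = n
eval (P ⊕ Q) n = eval P n + eval Q n
eval (P ⊛ Q) n = eval P n * eval Q n

-- In a sum both exponents are raised to `k + l`. This needs n ≥ 1, as `0 ^ 0` is 1 while the
-- positive powers of 0 vanish.
eval-bounded : ∀ P → ∃[ c ] ∃[ k ] ∀ n .{{_ : NonZero n}} → eval P n ≤ c * n ^ k
eval-bounded (con c) = c , 0 , λ n → ≤-reflexive (sym (*-identityʳ c))
eval-bounded var = 1 , 1 , λ n → ≤-reflexive (sym (trans (*-identityˡ (n ^ 1)) (*-identityʳ n)))
eval-bounded (P ⊕ Q) with eval-bounded P | eval-bounded Q
... | c , k , p | d , l , q = c + d , k + l , λ n → begin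
  eval P n + eval Q n           ≤⟨ +-mono-≤ (p n) (q n) ⟩
  c * n ^ k + d * n ^ l
    ≤⟨ +-mono-≤ (*-monoʳ-≤ c (^-monoʳ-≤ n (m≤m+n k l))) (*-monoʳ-≤ d (^-monoʳ-≤ n (m≤n+m l k))) ⟩
  c * n ^ (k + l) + d * n ^ (k + l) ≡⟨ *-distribʳ-+ (n ^ (k + l)) c d ⟨
  (c + d) * n ^ (k + l)         ∎
  where open ≤-Reasoning
eval-bounded (P ⊛ Q) with eval-bounded P | eval-bounded Q
... | c , k , p | d , l , q = c * d , k + l , λ n → begin
  eval P n * eval Q n           ≤⟨ *-mono-≤ (p n) (q n) ⟩
  (c * n ^ k) * (d * n ^ l)     ≡⟨ [m*n]*[o*p]≡[m*o]*[n*p] c (n ^ k) d (n ^ l) ⟩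
  (c * d) * (n ^ k * n ^ l)     ≡⟨ cong (c * d *_) (^-distribˡ-+-* n k l) ⟨
  (c * d) * n ^ (k + l)         ∎
  where open ≤-Reasoning

private variable
  α β γ σ : Type

infix 4 _·_⇓_within_
_·_⇓_within_ : Program α β → ⟦ α ⟧ → ⟦ β ⟧ → ℕ → Set
p · x ⇓ y within b = ∃[ t ] (p · x ⇓ y # t) × t ≤ b

step≤ : {p : Program α β} {x : ⟦ α ⟧} {y : ⟦ β ⟧} {t : ℕ} → p · x ⇓ y # t → p · x ⇓ y within t
step≤ r = _ , r , ≤-refl

seq≤ : {p : Program α β} {q : Program β γ} {x : ⟦ α ⟧} {y : ⟦ β ⟧} {z : ⟦ γ ⟧} {b c : ℕ} →
       p · x ⇓ y within b → q · y ⇓ z within c → p ⨾ q · x ⇓ z within suc (b + c)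
seq≤ (_ , r , r≤) (_ , s , s≤) = _ , seq r s , s≤s (+-mono-≤ r≤ s≤)

pair≤ : {p : Program α β} {q : Program α γ} {x : ⟦ α ⟧} {y : ⟦ β ⟧} {z : ⟦ γ ⟧} {b c : ℕ} →
        p · x ⇓ y within b → q · x ⇓ z within c → ⟨ p , q ⟩ · x ⇓ (y , z) within suc (b + c)
pair≤ (_ , r , r≤) (_ , s , s≤) = _ , pair r s , s≤s (+-mono-≤ r≤ s≤)

module _ (step : Program ((α ⊗ σ) ⊗ γ) σ) where

  nonEmpty : Program (list α ⊗ (σ ⊗ γ)) bool
  nonEmpty = caseList ff tt

  advance : Program ((α ⊗ list α) ⊗ (σ ⊗ γ)) (list α ⊗ (σ ⊗ γ))
  advance = ⟨ fst ⨾ snd ,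
              ⟨ ⟨ ⟨ fst ⨾ fst , snd ⨾ fst ⟩ , snd ⨾ snd ⟩ ⨾ step , snd ⨾ snd ⟩ ⟩

  foldlLoop : Program (list α ⊗ (σ ⊗ γ)) (list α ⊗ (σ ⊗ γ))
  -- The guard excludes the empty list; `⟨ nil , skip ⟩` merely fills that branch.
  foldlLoop = while nonEmpty (caseList ⟨ nil , skip ⟩ advance)

  -- `advance` takes 20 + b steps, the case distinction 1, the guard 2 and the loop rule 1. The
  -- final failing test accounts for the 3 in `foldlLoop-run`.
  roundCost : ℕ → ℕ
  roundCost b = 24 + b

  advance-run : ∀ {x xs s s′ c b} → step · ((x , s) , c) ⇓ s′ within b →
                advance · ((x , xs) , (s , c)) ⇓ (xs , (s′ , c)) within (20 + b)
  advance-run {b = b} r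
    with t , r′ , t≤ ← pair≤ (seq≤ (step≤ fst) (step≤ snd))
            (pair≤ (seq≤ (pair≤ (pair≤ (seq≤ (step≤ fst) (step≤ fst)) (seq≤ (step≤ snd) (step≤ fst)))
                                (seq≤ (step≤ snd) (step≤ snd))) r)
                   (seq≤ (step≤ snd) (step≤ snd)))
    = t , r′ , ≤-trans t≤ (≤-reflexive (cong (17 +_) (+-comm b _)))

  -- The state is a function `st` of the indices processed so far, latest first, which makes the
  -- loop invariant part of its form. The step is assumed correct only for lists shorter than `N`,
  -- so that one bound `b` can cover states that grow with each round.
  foldlLoop-run : {J : Set} (f : J → ⟦ α ⟧) (st : List J → ⟦ σ ⟧) (c : ⟦ γ ⟧) (N b : ℕ) →
    (∀ j js → length js < N → step · ((f j , st js) , c) ⇓ st (j ∷ js) within b) →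
    ∀ js acc → length js + length acc ≤ N →
    foldlLoop · (map f js , (st acc , c)) ⇓ ([] , (st (js ʳ++ acc) , c)) within
      (length js * roundCost b + 3)
  foldlLoop-run f st c N b h [] acc _ = step≤ (while-false (case-[] ff))
  foldlLoop-run f st c N b h (j ∷ js) acc le
    with t , r , t≤ ← advance-run {xs = map f js}
      (h j acc (≤-trans (s≤s (m≤n+m (length acc) (length js))) le))
       | u , q , u≤ ← foldlLoop-run f st c N b h js (j ∷ acc)
         (≤-trans (≤-reflexive (+-suc (length js) (length acc))) le)
    = _ , while-true (case-∷ tt) (case-∷ r) q
    , ≤-trans (+-mono-≤ (s≤s (s≤s (s≤s (s≤s t≤)))) u≤)
              (≤-reflexive (sym (+-assoc (24 + b) (length js * (24 + b)) 3)))

relax : {p : Program α β} {x : ⟦ α ⟧} {y : ⟦ β ⟧} {b c : ℕ} → p · x ⇓ y within b → b ≤ c →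
  p · x ⇓ y within c
relax (t , r , le) le′ = t , r , ≤-trans le le′

reverseP : Program (list α) (list α)
reverseP = ⟨ skip , ⟨ nil , tt ⟩ ⟩ ⨾ foldlLoop {γ = bool} (fst ⨾ cons) ⨾ snd ⨾ fst

reverseP-run : (xs : List ⟦ α ⟧) → reverseP {α} · xs ⇓ reverse xs within (7 + (length xs * 27 + 3 + 3))
reverseP-run {α} xs = subst
  (λ ys → reverseP {α} · ys ⇓ reverse xs within (7 + (length xs * 27 + 3 + 3))) (map-id xs)
  (seq≤ (pair≤ (step≤ skip) (pair≤ (step≤ nil) (step≤ tt)))
        (seq≤ (foldlLoop-run (fst ⨾ cons) id id true (length xs) 3
                 (λ _ _ _ → seq≤ (step≤ fst) (step≤ cons)) xs [] (≤-reflexive (+-identityʳ _)))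
              (seq≤ (step≤ snd) (step≤ fst))))

-- A right fold consumes the last element first, hence the reversal before the loop.
foldrP : Program ((α ⊗ σ) ⊗ γ) σ → Program (list α ⊗ (σ ⊗ γ)) σ
foldrP step = ⟨ fst ⨾ reverseP , snd ⟩ ⨾ foldlLoop step ⨾ snd ⨾ fst

foldrP-run : (step : Program ((α ⊗ σ) ⊗ γ) σ) {J : Set} (f : J → ⟦ α ⟧) (st : List J → ⟦ σ ⟧)
  (c : ⟦ γ ⟧) (b : ℕ) (is : List J) →
  (∀ j js → length js < length is → step · ((f j , st js) , c) ⇓ st (j ∷ js) within b) →
  foldrP step · (map f is , (st [] , c)) ⇓ st is within
    (13 + (length is * 27 + 6 + (length is * (24 + b) + 6)))
foldrP-run {α} {σ} {γ} step {J} f st c b is h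
  with r ← reverseP-run {α} (map f is)
     | q ← foldlLoop-run step f st c (length is) b h (reverse is) []
       (≤-reflexive (trans (+-identityʳ _) (length-reverse is)))
  rewrite length-map f is | sym (reverse-map f is) | length-reverse is
        | reverse-involutive is
  = relax (seq≤ (pair≤ (seq≤ (step≤ fst) r) (step≤ snd)) (seq≤ q (seq≤ (step≤ snd) (step≤ fst))))
     (≤-reflexive (shuffle (length is * 27) (length is * (24 + b))))
  where
  open +-*-Solver using (solve; _:+_; con; _:=_)
  shuffle : ∀ x y → suc (suc (suc (1 + (7 + (x + 3 + 3))) + 1) + suc (y + 3 + 3)) ≡ 13 + (x + 6 + (y + 6))
  shuffle = solve 2 (λ x y →
      con 1 :+ (con 1 :+ (con 1 :+ (con 1 :+ (con 7 :+ (x :+ con 3 :+ con 3)))) :+ con 1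
        :+ (con 1 :+ (y :+ con 3 :+ con 3)))
      := con 13 :+ (x :+ con 6 :+ (y :+ con 6))) refl

-- `Index` holds mathematical objects such as graphs and vertices; `val` is their encoding, which is
-- all that a program sees.
record Env : Set₁ where
  constructor env
  field
    {type} : Type
    {Index} : ℕ → Set
    val    : ∀ n → Index n → ⟦ type ⟧

open Env

infix 3 _⊢_∋_

-- Γ ⊢ β ∋ y: a single program computes y n i from val Γ n i for all indices i,
-- in time polynomial in n.
record _⊢_∋_ (Γ : Env) (β : Type) (y : ∀ n → Index Γ n → ⟦ β ⟧) : Set where
  constructor computation
  field
    {prog}  : Program (type Γ) β
    {bound} : Polynomial
    run     : ∀ n i → prog · val Γ n i ⇓ y n i within eval bound n

open _⊢_∋_

infixl 5 _▷_∋_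
_▷_∋_ : (Γ : Env) (α : Type) → (∀ n → Index Γ n → ⟦ α ⟧) → Env
Γ ▷ α ∋ x = env {α ⊗ type Γ} λ n i → x n i , val Γ n i

-- Adds mathematical data to the index without storing anything; a binder combines it with `_▷_∋_`.
_∣_ : (Γ : Env) (J : ∀ n → Index Γ n → Set) → Env
Γ ∣ J = env {Index = λ n → Σ (Index Γ n) (J n)} λ n (i , _) → val Γ n i

module _ {Γ : Env} where

  inputᶜ : Γ ⊢ type Γ ∋ val Γ
  inputᶜ = computation {bound = con 1} λ n i → step≤ skip

  fstᶜ : ∀ {α β} {x : ∀ n → Index Γ n → ⟦ α ⟧} {y : ∀ n → Index Γ n → ⟦ β ⟧} →
    Γ ⊢ α ⊗ β ∋ (λ n i → x n i , y n i) → Γ ⊢ α ∋ x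
  fstᶜ c = computation {bound = con 1 ⊕ (bound c ⊕ con 1)} λ n i → seq≤ (run c n i) (step≤ fst)

  sndᶜ : ∀ {α β} {x : ∀ n → Index Γ n → ⟦ α ⟧} {y : ∀ n → Index Γ n → ⟦ β ⟧} →
    Γ ⊢ α ⊗ β ∋ (λ n i → x n i , y n i) → Γ ⊢ β ∋ y
  sndᶜ c = computation {bound = con 1 ⊕ (bound c ⊕ con 1)} λ n i → seq≤ (run c n i) (step≤ snd)

  pairᶜ : ∀ {α β x y} → Γ ⊢ α ∋ x → Γ ⊢ β ∋ y → Γ ⊢ α ⊗ β ∋ (λ n i → x n i , y n i)
  pairᶜ c d = computation {bound = con 1 ⊕ (bound c ⊕ bound d)} λ n i → pair≤ (run c n i) (run d n i)

  call : ∀ {Δ : Env} {β y} → Δ ⊢ β ∋ y → (h : ∀ n → Index Γ n → Index Δ n) →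
         Γ ⊢ type Δ ∋ (λ n i → val Δ n (h n i)) → Γ ⊢ β ∋ (λ n i → y n (h n i))
  call c h a = computation {bound = con 1 ⊕ (bound a ⊕ bound c)} λ n i → seq≤ (run a n i) (run c n (h n i))

  cast : ∀ {β x y} → (∀ n i → x n i ≡ y n i) → Γ ⊢ β ∋ x → Γ ⊢ β ∋ y
  cast {β} eq c = computation {bound = bound c} λ n i →
    subst (λ z → prog c · val Γ n i ⇓ z within eval (bound c) n) (eq n i) (run c n i)

  trueᶜ : Γ ⊢ bool ∋ (λ _ _ → true)
  trueᶜ = computation {bound = con 1} λ n i → step≤ tt

  falseᶜ : Γ ⊢ bool ∋ (λ _ _ → false)
  falseᶜ = computation {bound = con 1} λ n i → step≤ ff

  zeroᶜ : Γ ⊢ nat ∋ (λ _ _ → 0)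
  zeroᶜ = computation {bound = con 1} λ n i → step≤ ze

  sucᶜ : ∀ {m} → Γ ⊢ nat ∋ m → Γ ⊢ nat ∋ (λ n i → suc (m n i))
  sucᶜ c = computation {bound = con 1 ⊕ (bound c ⊕ con 1)} λ n i → seq≤ (run c n i) (step≤ su)

  nilᶜ : ∀ {α} → Γ ⊢ list α ∋ (λ _ _ → [])
  nilᶜ = computation {bound = con 1} λ n i → step≤ nil

  consᶜ : ∀ {α x xs} → Γ ⊢ α ∋ x → Γ ⊢ list α ∋ xs → Γ ⊢ list α ∋ (λ n i → x n i ∷ xs n i)
  consᶜ c d = computation {bound = con 1 ⊕ (con 1 ⊕ (bound c ⊕ bound d) ⊕ con 1)} λ n i →
    seq≤ (pair≤ (run c n i) (run d n i)) (step≤ cons)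

  ifᶜ : ∀ {β b x y} → Γ ⊢ bool ∋ b → Γ ⊢ β ∋ x → Γ ⊢ β ∋ y →
        Γ ⊢ β ∋ (λ n i → if b n i then x n i else y n i)
  ifᶜ {β} {b} {x} {y} cb cx cy =
    computation {prog = ifte (prog cb) (prog cx) (prog cy)}
      {bound = con 1 ⊕ (bound cb ⊕ (bound cx ⊕ bound cy))} go
    where
    go : ∀ n i → ifte (prog cb) (prog cx) (prog cy) · val Γ n i ⇓ (if b n i then x n i else y n i) within _
    go n i with b n i | run cb n i
    ... | true  | t , r , t≤ = let u , q , u≤ = run cx n i in
      _ , if-true r q , s≤s (+-mono-≤ t≤ (≤-trans u≤ (m≤m+n _ _)))
    ... | false | t , r , t≤ = let u , q , u≤ = run cy n i in
      _ , if-false r q , s≤s (+-mono-≤ t≤ (≤-trans u≤ (m≤n+m _ _)))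

  notᶜ : ∀ {b} → Γ ⊢ bool ∋ b → Γ ⊢ bool ∋ (λ n i → not (b n i))
  notᶜ {b} c = cast (λ n i → lemma (b n i)) (ifᶜ c falseᶜ trueᶜ)
    where
    lemma : ∀ b → (if b then false else true) ≡ not b
    lemma true  = refl
    lemma false = refl

  andᶜ : ∀ {b c} → Γ ⊢ bool ∋ b → Γ ⊢ bool ∋ c → Γ ⊢ bool ∋ (λ n i → b n i ∧ c n i)
  andᶜ {b} {c} x y = cast (λ n i → lemma (b n i)) (ifᶜ x y falseᶜ)
    where
    lemma : ∀ b {c} → (if b then c else false) ≡ b ∧ c
    lemma true  = refl
    lemma false = refl

  orᶜ : ∀ {b c} → Γ ⊢ bool ∋ b → Γ ⊢ bool ∋ c → Γ ⊢ bool ∋ (λ n i → b n i ∨ c n i)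
  orᶜ {b} {c} x y = cast (λ n i → lemma (b n i)) (ifᶜ x trueᶜ y)
    where
    lemma : ∀ b {c} → (if b then true else c) ≡ b ∨ c
    lemma true  = refl
    lemma false = refl

  predᶜ : ∀ {m} → Γ ⊢ nat ∋ m → Γ ⊢ nat ∋ (λ n i → pred (m n i))
  predᶜ {m} c = computation {prog = ⟨ prog c , tt ⟩ ⨾ caseNat {α = bool} ze fst}
    {bound = con 1 ⊕ (con 1 ⊕ (bound c ⊕ con 1) ⊕ con 2)} λ n i →
    seq≤ (pair≤ (run c n i) (step≤ tt)) (go (m n i))
    where
    go : ∀ m → caseNat {α = bool} ze fst · (m , true) ⇓ pred m within 2
    go zero    = step≤ (case-zero ze)
    go (suc m) = step≤ (case-suc fst)

  positiveᶜ : ∀ {m} → Γ ⊢ nat ∋ m → Γ ⊢ bool ∋ (λ n i → 0 <ᵇ m n i)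
  positiveᶜ {m} c = computation {prog = ⟨ prog c , tt ⟩ ⨾ caseNat {α = bool} ff tt}
    {bound = con 1 ⊕ (con 1 ⊕ (bound c ⊕ con 1) ⊕ con 2)} λ n i →
    seq≤ (pair≤ (run c n i) (step≤ tt)) (go (m n i))
    where
    go : ∀ m → caseNat {α = bool} ff tt · (m , true) ⇓ (0 <ᵇ m) within 2
    go zero    = step≤ (case-zero ff)
    go (suc m) = step≤ (case-suc tt)

  -- The bound `len n i ≤ n` keeps the number of rounds linear. The environment of the step records
  -- that fewer than `len n i` elements have been consumed, so that a loop over the consumed part,
  -- nested in the step, is bounded as well.
  foldᶜ : ∀ {α σ} (len : ∀ n → Index Γ n → ℕ) → (∀ n i → len n i ≤ n) →
          {xs : ∀ n i → Fin (len n i) → ⟦ α ⟧} (st : ∀ n i → List (Fin (len n i)) → ⟦ σ ⟧) →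
          Γ ⊢ list α ∋ (λ n i → tabulate (xs n i)) →
          Γ ⊢ σ ∋ (λ n i → st n i []) →
          ((Γ ∣ λ n i → Fin (len n i) × Σ (List (Fin (len n i))) λ js → length js < len n i)
            ▷ α ⊗ σ ∋ λ n (i , j , js , _) → xs n i j , st n i js) ⊢ σ
              ∋ (λ n (i , j , js , _) → st n i (j ∷ js)) →
          Γ ⊢ σ ∋ (λ n i → st n i (allFin (len n i)))
  foldᶜ {α} len len≤ {xs} st cx c₀ c = computation
    {bound = con 1 ⊕ ((con 1 ⊕ (bound cx ⊕ (con 1 ⊕ (bound c₀ ⊕ con 1)))) ⊕
       (con 13 ⊕ (var ⊛ con 27 ⊕ con 6 ⊕ (var ⊛ (con 24 ⊕ bound c) ⊕ con 6))))}
    λ n i → seq≤ (pair≤ (run cx n i) (pair≤ (run c₀ n i) (step≤ skip)))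
      (relax (subst (λ ys → foldrP (prog c) · (ys , st n i [] , val Γ n i) ⇓ st n i
        (allFin (len n i)) within _)
               (map-tabulate id (xs n i))
               (foldrP-run (prog c) (xs n i) (st n i) (val Γ n i) (eval (bound c) n) (allFin (len n i))
                 λ j js lt → run c n (i , j , js ,
                   subst (length js <_) (length-tabulate {n = len n i} id) lt)))
             (+-monoʳ-≤ 13 (+-mono-≤ (+-monoˡ-≤ 6 (*-monoˡ-≤ 27 (len≤′ n i)))
                                      (+-monoˡ-≤ 6 (*-monoˡ-≤ _ (len≤′ n i))))))
    where
    len≤′ : ∀ n i → length (allFin (len n i)) ≤ n
    len≤′ n i = subst (_≤ n) (sym (length-tabulate {n = len n i} id)) (len≤ n i)

-- The algorithm

VertexSet : ℕ → Set
VertexSet n = Fin n → Bool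

Relation : ℕ → Set
Relation n = Fin n → Fin n → Bool

private variable
  n : ℕ
  X Y : Set

full empty : VertexSet n
full  _ = true
empty _ = false

singleton : Fin n → VertexSet n
singleton x y = does (x ≟ y)

_∖_ : VertexSet n → VertexSet n → VertexSet n
(C ∖ S) y = C y ∧ not (S y)

iterate : ℕ → (X → X) → X → X
iterate zero    f x = x
iterate (suc k) f x = f (iterate k f x)

exists : VertexSet n → Bool
exists S = foldr (λ j b → S j ∨ b) false (allFin _)

count : VertexSet n → ℕ
count S = foldr (λ j m → if S j then suc m else m) 0 (allFin _)

choose : VertexSet n → (Fin n → X) → X → X
choose b f d = foldr (λ j x → if b j then f j else x) d (allFin _)

-- Tests 2 |S| ≤ |C| as 0 < (|C| + 1) ∸ 2 |S|, with two predecessors for each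
-- vertex of S.
atMostHalf : VertexSet n → VertexSet n → Bool
atMostHalf S C = 0 <ᵇ foldr (λ j m → if S j then pred (pred m) else m) (suc (count C)) (allFin _)

module Spanner (A : Relation n) where

  grow : VertexSet n → VertexSet n → VertexSet n
  grow C S y = S y ∨ (C y ∧ exists (λ x → S x ∧ A y x))

  -- Empty when `x` lies outside `C`. Since n rounds of growth always reach a fixed point, no
  -- termination test is made.
  component : VertexSet n → Fin n → VertexSet n
  component C x = iterate n (grow C) (λ y → C y ∧ singleton x y)

  balanced : VertexSet n → VertexSet n → Bool
  balanced C S = not (exists λ x → not (atMostHalf (component (C ∖ S) x) C))

  -- All disks grow together, in the whole graph rather than in `C`, and freeze once one of them is
  -- balanced. This finds the least radius without arithmetic.
  widen : VertexSet n → (Fin n → VertexSet n) → Fin n → VertexSet n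
  widen C D = if exists (λ v → balanced C (D v)) then D else (λ v → grow full (D v))

  disks : VertexSet n → Fin n → VertexSet n
  disks C = iterate n (widen C) singleton

  -- Both make the same test and so select the same vertex, once as a singleton and once with its
  -- disk.
  centre separator : VertexSet n → VertexSet n
  centre    C = choose (λ v → balanced C (disks C v)) singleton empty
  separator C = choose (λ v → balanced C (disks C v)) (disks C) empty

  -- Stops one round before `x` would be absorbed. Started from a vertex v other than `x` in a
  -- connected graph, it yields the disk about v of radius d(x,v) - 1, so a neighbour of `x` in it
  -- begins a shortest path to v.
  approach : Fin n → VertexSet n → VertexSet n
  approach x = iterate n (λ S → if grow full S x then S else grow full S)

  parent : Fin n → VertexSet n → VertexSet n
  parent x s = choose (λ y → approach x s y ∧ A y x) singleton empty

  -- A normal form, so that pointwise equal components have the same centre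
  -- and separator.
  componentᴺ : VertexSet n → Fin n → VertexSet n
  componentᴺ R x = Vec.lookup (Vec.tabulate (component R x))

  next : VertexSet n → VertexSet n
  next R x = R x ∧ not (separator (componentᴺ R x) x)

  remaining : ℕ → VertexSet n
  remaining k = iterate k next full

  parentEdges : VertexSet n → Relation n
  parentEdges R x y = R x ∧ parent x (centre (componentᴺ R x)) y

  chosen : ℕ → Relation n
  chosen zero    x y = false
  chosen (suc k) x y = chosen k x y ∨ parentEdges (remaining k) x y

  -- Running n levels avoids computing a logarithm; from level ⌊log₂ n⌋ on nothing is added, by
  -- `no-edges`.
  spanner : Relation n
  spanner x y = chosen n x y ∨ chosen n y x

-- Programs for the algorithm

foldr-length : (f : X → X) (x : X) (js : List Y) → foldr (λ _ → f) x js ≡ iterate (length js) f x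
foldr-length f x []       = refl
foldr-length f x (j ∷ js) = cong f (foldr-length f x js)

map-allFin : (f : Fin n → X) → map f (allFin n) ≡ tabulate f
map-allFin f = map-tabulate id f

-- One step of zipping by a right fold. Positions are met from last to first, so the second list
-- must be supplied reversed.
pop : X → List Y × List (X × Y) → List Y × List (X × Y)
pop x ([]     , zs) = [] , zs
pop x (y ∷ ys , zs) = ys , (x , y) ∷ zs

foldr-pop : {J : Set} (f : J → X) (g : J → Y) (js : List J) (ys : List Y) →
            foldr (pop ∘ f) (map g js ʳ++ ys , []) js ≡ (ys , map (λ j → f j , g j) js)
foldr-pop f g []       ys = refl
foldr-pop f g (j ∷ js) ys rewrite foldr-pop f g js (g j ∷ ys) = refl

choose-float : {b : VertexSet n} (h : X → Y) {f : Fin n → X} {d : X} →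
               choose b (h ∘ f) (h d) ≡ h (choose b f d)
choose-float {n} {b = b} h {f} {d} = go (allFin n)
  where
  go : ∀ js → foldr (λ j x → if b j then h (f j) else x) (h d) js
    ≡ h (foldr (λ j x → if b j then f j else x) d js)
  go [] = refl
  go (j ∷ js) with b j
  ... | true  = refl
  ... | false = go js

-- Its rows are the characteristic vectors by which programs represent vertices, so that looking up
-- an entry needs no arithmetic on indices.
identityMatrix : (k : ℕ) → List (List Bool)
identityMatrix k = tabulate {n = k} (λ x → tabulate (singleton x))

module _ {Γ : Env} where

  mapLenᶜ : ∀ {α β} (len : ∀ n → Index Γ n → ℕ) → (∀ n i → len n i ≤ n) →
         {xs : ∀ n i → Fin (len n i) → ⟦ α ⟧} {y : ∀ n → Σ (Index Γ n) (λ i → Fin (len n i)) → ⟦ β ⟧} →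
         Γ ⊢ list α ∋ (λ n i → tabulate (xs n i)) →
         (Γ ∣ λ n i → Fin (len n i)) ▷ α ∋ (λ n (i , j) → xs n i j) ⊢ β ∋ y →
         Γ ⊢ list β ∋ (λ n i → tabulate λ j → y n (i , j))
  mapLenᶜ {α} {β} len len≤ {xs} {y} cx c = cast (λ n i → map-allFin _)
    (foldᶜ len len≤ (λ n i → map (λ j → y n (i , j))) cx nilᶜ
      (consᶜ (call c (λ n (i , j , _) → i , j) (pairᶜ (fstᶜ (fstᶜ inputᶜ)) (sndᶜ inputᶜ)))
        (sndᶜ (fstᶜ inputᶜ))))

  mapᶜ : ∀ {α β} {xs : ∀ n → Index Γ n → Fin n → ⟦ α ⟧} {y : ∀ n → Σ (Index Γ n) (λ i → Fin n) → ⟦ β ⟧} →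
         Γ ⊢ list α ∋ (λ n i → tabulate (xs n i)) →
         (Γ ∣ λ n i → Fin n) ▷ α ∋ (λ n (i , j) → xs n i j) ⊢ β ∋ y →
         Γ ⊢ list β ∋ (λ n i → tabulate λ j → y n (i , j))
  mapᶜ = mapLenᶜ (λ n _ → n) (λ _ _ → ≤-refl)

  foldrᶜ : ∀ {α σ} {xs : ∀ n → Index Γ n → Fin n → ⟦ α ⟧} (st : ∀ n → Index Γ n → List (Fin n) → ⟦ σ ⟧) →
          Γ ⊢ list α ∋ (λ n i → tabulate (xs n i)) →
          Γ ⊢ σ ∋ (λ n i → st n i []) →
          ((Γ ∣ λ n _ → Fin n × Σ (List (Fin n)) λ js → length js < n)
            ▷ α ⊗ σ ∋ λ n (i , j , js , _) → xs n i j , st n i js) ⊢ σ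
              ∋ (λ n (i , j , js , _) → st n i (j ∷ js)) →
          Γ ⊢ σ ∋ (λ n i → st n i (allFin n))
  foldrᶜ = foldᶜ (λ n _ → n) (λ _ _ → ≤-refl)

  reverseᶜ : ∀ {α} {xs : ∀ n → Index Γ n → Fin n → ⟦ α ⟧} → Γ ⊢ list α ∋ (λ n i → tabulate (xs n i)) →
             Γ ⊢ list α ∋ (λ n i → map (xs n i) (allFin n) ʳ++ [])
  reverseᶜ {α} {xs} c = computation {bound = con 1 ⊕ (bound c ⊕ (con 7 ⊕ (var ⊛ con 27 ⊕ con 3 ⊕ con 3)))}
    λ n i → seq≤ (run c n i)
      (subst₂ (λ ys b → reverseP · ys ⇓ map (xs n i) (allFin n) ʳ++ [] within (7 + (b * 27 + 3 + 3)))
        (map-allFin (xs n i)) (trans (cong length (map-allFin (xs n i))) (length-tabulate (xs n i)))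
        (reverseP-run {α} (map (xs n i) (allFin n))))

  popᶜ : ∀ {α β} {x : ∀ n → Index Γ n → ⟦ α ⟧} {p : ∀ n → Index Γ n → List ⟦ β ⟧ × List (⟦ α ⟧ × ⟦ β ⟧)} →
         Γ ⊢ α ∋ x → Γ ⊢ list β ⊗ list (α ⊗ β) ∋ p →
           Γ ⊢ list β ⊗ list (α ⊗ β) ∋ (λ n i → pop (x n i) (p n i))
  popᶜ {α} {β} {x} {p} c d = computation
    {bound = con 1 ⊕ (con 1 ⊕ (con 1 ⊕ (bound d ⊕ con 1)
      ⊕ (con 1 ⊕ (bound c ⊕ (con 1 ⊕ (bound d ⊕ con 1))))) ⊕ con 18)}
    λ n i → seq≤ (pair≤ (seq≤ (run d n i) (step≤ fst))
      (pair≤ (run c n i) (seq≤ (run d n i) (step≤ snd)))) (go (x n i) (p n i))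
    where
    popP : Program (list β ⊗ (α ⊗ list (α ⊗ β))) (list β ⊗ list (α ⊗ β))
    popP = caseList ⟨ nil , snd ⟩ ⟨ fst ⨾ snd , ⟨ ⟨ snd ⨾ fst , fst ⨾ fst ⟩ , snd ⨾ snd ⟩ ⨾ cons ⟩
    go : ∀ x p → popP · (proj₁ p , x , proj₂ p) ⇓ pop x p within 18
    go x ([]     , zs) = _ , case-[] (pair nil snd) , m≤m+n 4 14
    go x (y ∷ ys , zs) = _ , case-∷
      (pair (seq fst snd) (seq (pair (pair (seq snd fst) (seq fst fst)) (seq snd snd)) cons)) , ≤-refl

module _ {Γ : Env} where

  zipᶜ : ∀ {α β} {xs : ∀ n → Index Γ n → Fin n → ⟦ α ⟧} {ys : ∀ n → Index Γ n → Fin n → ⟦ β ⟧} →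
         Γ ⊢ list α ∋ (λ n i → tabulate (xs n i)) → Γ ⊢ list β ∋ (λ n i → tabulate (ys n i)) →
         Γ ⊢ list (α ⊗ β) ∋ (λ n i → tabulate λ j → xs n i j , ys n i j)
  zipᶜ {α} {β} {xs} {ys} c d = cast (λ n i → map-allFin _)
    (sndᶜ {x = λ _ _ → []} (cast (λ n i → foldr-pop (xs n i) (ys n i) (allFin n) [])
      (foldrᶜ (λ n i → foldr (pop ∘ xs n i) (map (ys n i) (allFin n) ʳ++ [] , []))
        c (pairᶜ (reverseᶜ d) nilᶜ)
        (popᶜ (fstᶜ (fstᶜ inputᶜ)) (sndᶜ (fstᶜ inputᶜ))))))

  existsᶜ : ∀ {S : ∀ n → Index Γ n → VertexSet n} → Γ ⊢ list bool ∋ (λ n i → tabulate (S n i)) →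
            Γ ⊢ bool ∋ (λ n i → exists (S n i))
  existsᶜ {S} c = foldrᶜ (λ n i → foldr (λ j b → S n i j ∨ b) false) c falseᶜ
    (orᶜ (fstᶜ (fstᶜ inputᶜ)) (sndᶜ (fstᶜ inputᶜ)))

  countᶜ : ∀ {S : ∀ n → Index Γ n → VertexSet n} → Γ ⊢ list bool ∋ (λ n i → tabulate (S n i)) →
           Γ ⊢ nat ∋ (λ n i → count (S n i))
  countᶜ {S} c = foldrᶜ (λ n i → foldr (λ j m → if S n i j then suc m else m) 0) c zeroᶜ
    (ifᶜ (fstᶜ (fstᶜ inputᶜ)) (sucᶜ (sndᶜ (fstᶜ inputᶜ))) (sndᶜ (fstᶜ inputᶜ)))

  atMostHalfᶜ : ∀ {S C : ∀ n → Index Γ n → VertexSet n} →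
                Γ ⊢ list bool ∋ (λ n i → tabulate (S n i)) → Γ ⊢ list bool ∋ (λ n i → tabulate (C n i)) →
                Γ ⊢ bool ∋ (λ n i → atMostHalf (S n i) (C n i))
  atMostHalfᶜ {S} {C} c d =
    positiveᶜ (foldrᶜ (λ n i → foldr (λ j m → if S n i j then pred (pred m) else m) (suc (count (C n i))))
    c (sucᶜ (countᶜ d))
    (ifᶜ (fstᶜ (fstᶜ inputᶜ)) (predᶜ (predᶜ (sndᶜ (fstᶜ inputᶜ)))) (sndᶜ (fstᶜ inputᶜ))))

  chooseᶜ : ∀ {α} {b : ∀ n → Index Γ n → VertexSet n} {f : ∀ n → Index Γ n → Fin n → ⟦ α ⟧}
    {d : ∀ n → Index Γ n → ⟦ α ⟧} →
            Γ ⊢ list bool ∋ (λ n i → tabulate (b n i)) → Γ ⊢ list α ∋ (λ n i → tabulate (f n i)) →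
              Γ ⊢ α ∋ d →
            Γ ⊢ α ∋ (λ n i → choose (b n i) (f n i) (d n i))
  chooseᶜ {b = b} {f} {d} cb cf cd = foldrᶜ (λ n i → foldr (λ j x → if b n i j then f n i j else x) (d n i))
    (zipᶜ cb cf) cd (ifᶜ (fstᶜ (fstᶜ (fstᶜ inputᶜ))) (sndᶜ (fstᶜ (fstᶜ inputᶜ))) (sndᶜ (fstᶜ inputᶜ)))

  chooseSetᶜ : ∀ {b : ∀ n → Index Γ n → VertexSet n} {f : ∀ n → Index Γ n → Relation n}
    {d : ∀ n → Index Γ n → VertexSet n} →
            Γ ⊢ list bool ∋ (λ n i → tabulate (b n i)) →
              Γ ⊢ matrix ∋ (λ n i → tabulate λ x → tabulate (f n i x)) →
            Γ ⊢ list bool ∋ (λ n i → tabulate (d n i)) →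
            Γ ⊢ list bool ∋ (λ n i → tabulate (choose (b n i) (f n i) (d n i)))
  chooseSetᶜ {b} {f} {d} cb cf cd =
    cast (λ n i → choose-float {b = b n i} tabulate {f n i} {d n i}) (chooseᶜ cb cf cd)

  -- The list of the `S n i` provides n as its length, so the iteration becomes a fold over it. The
  -- body has to run within one bound on every element of `X n i`, not only on the iterates.
  iterateᶜ : ∀ {α σ} {S : ∀ n → Index Γ n → Fin n → ⟦ α ⟧} {X : ∀ n → Index Γ n → Set}
    (enc : ∀ n i → X n i → ⟦ σ ⟧)
             (f : ∀ n i → X n i → X n i) {x : ∀ n i → X n i} →
             Γ ⊢ list α ∋ (λ n i → tabulate (S n i)) →
             Γ ⊢ σ ∋ (λ n i → enc n i (x n i)) →
             (Γ ∣ X) ▷ σ ∋ (λ n (i , y) → enc n i y) ⊢ σ ∋ (λ n (i , y) → enc n i (f n i y)) →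
             Γ ⊢ σ ∋ (λ n i → enc n i (iterate n (f n i) (x n i)))
  iterateᶜ enc f {x} cS cx c = cast
    (λ n i → cong (enc n i) (trans (foldr-length (f n i) (x n i) (allFin n))
      (cong (λ k → iterate k (f n i) (x n i)) (length-tabulate {n = n} id))))
    (foldrᶜ (λ n i js → enc n i (foldr (λ _ → f n i) (x n i) js)) cS cx
      (call c (λ n (i , j , js , _) → i , foldr (λ _ → f n i) (x n i) js)
        (pairᶜ (sndᶜ (fstᶜ inputᶜ)) (sndᶜ inputᶜ))))

  -- Grows from the lower right corner: each round prefixes `false` to the rows built so far and
  -- puts a row with leading `true` on top.
  identityᶜ : ∀ {α} {S : ∀ n → Index Γ n → Fin n → ⟦ α ⟧} → Γ ⊢ list α ∋ (λ n i → tabulate (S n i)) →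
              Γ ⊢ matrix ∋ (λ n i → tabulate {n = n} λ x → tabulate (singleton x))
  identityᶜ c = cast (λ n i → cong identityMatrix (length-tabulate {n = n} id))
    (foldrᶜ (λ n i js → identityMatrix (length js)) c nilᶜ
      (consᶜ (consᶜ trueᶜ (mapLenᶜ (λ n (_ , _ , js , _) → length js)
        (λ n (_ , _ , _ , lt) → <⇒≤ lt) (sndᶜ (fstᶜ inputᶜ)) falseᶜ))
             (mapLenᶜ (λ n (_ , _ , js , _) → length js) (λ n (_ , _ , _ , lt) → <⇒≤ lt)
               (sndᶜ (fstᶜ inputᶜ)) (consᶜ falseᶜ (fstᶜ inputᶜ)))))

choose-singleton : ∀ {n} {X : Set} (x : Fin n) (f : Fin n → X) (d : X) → choose (singleton x) f d ≡ f x
choose-singleton {n} {X} x f d = go (allFin n) (∈-allFin x)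
  where
  go : ∀ js → x ∈ js → foldr (λ j y → if singleton x j then f j else y) d js ≡ f x
  go (j ∷ js) x∈ with x ≟ j | x∈
  ... | yes refl | _         = refl
  ... | no x≢j   | here x≡j  = contradiction x≡j x≢j
  ... | no x≢j   | there x∈′ = go js x∈′

_∋ᵛ_ : (Γ : Env) → (∀ n → Index Γ n → VertexSet n) → Set
Γ ∋ᵛ S = Γ ⊢ list bool ∋ λ n i → tabulate (S n i)

_∋ᵐ_ : (Γ : Env) → (∀ n → Index Γ n → Relation n) → Set
Γ ∋ᵐ A = Γ ⊢ matrix ∋ λ n i → tabulate λ x → tabulate (A n i x)

infix 3 _∋ᵛ_ _∋ᵐ_

-- Under a binder a computation is repeated rather than its result stored, at
-- the cost of a polynomial factor only.
weaken : ∀ {Γ α β} {J : ∀ n → Index Γ n → Set} {x} {y : ∀ n → Index Γ n → ⟦ β ⟧} →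
         Γ ⊢ β ∋ y → (Γ ∣ J) ▷ α ∋ x ⊢ β ∋ (λ n (i , _) → y n i)
weaken c = call c (λ n (i , _) → i) (sndᶜ inputᶜ)

vertices▷ : Env → Env
vertices▷ Γ = (Γ ∣ λ n _ → Fin n) ▷ list bool ∋ λ n (_ , x) → tabulate (singleton x)

-- Comprehension over the vertices. The list `S` provides n, and the body receives its vertex as a
-- characteristic vector.
setᶜ : ∀ {Γ α β} {S : ∀ n → Index Γ n → Fin n → ⟦ α ⟧} {y : ∀ n → Σ (Index Γ n) (λ i → Fin n) → ⟦ β ⟧} →
       Γ ⊢ list α ∋ (λ n i → tabulate (S n i)) →
       vertices▷ Γ ⊢ β ∋ y → Γ ⊢ list β ∋ λ n i → tabulate λ x → y n (i , x)
setᶜ s c = mapᶜ (identityᶜ s) c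

this : ∀ {Γ} → vertices▷ Γ ∋ᵛ λ n (_ , x) → singleton x
this = fstᶜ inputᶜ

module _ {Γ : Env} where

  -- Indexing is `choose` with the characteristic vector as the test. The default is never returned,
  -- because the vector has a true entry.
  lookupᶜ : ∀ {α} {f : ∀ n → Index Γ n → Fin n → ⟦ α ⟧} {x : ∀ n → Index Γ n → Fin n}
    {d : ∀ n → Index Γ n → ⟦ α ⟧} →
            Γ ⊢ α ∋ d → Γ ⊢ list α ∋ (λ n i → tabulate (f n i)) → Γ ∋ᵛ (λ n i → singleton (x n i)) →
            Γ ⊢ α ∋ λ n i → f n i (x n i)
  lookupᶜ {f = f} {x} {d} cd cf cx =
    cast (λ n i → choose-singleton (x n i) (f n i) (d n i)) (chooseᶜ cx cf cd)

  memberᶜ : ∀ {S : ∀ n → Index Γ n → VertexSet n} {x : ∀ n → Index Γ n → Fin n} →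
            Γ ∋ᵛ S → Γ ∋ᵛ (λ n i → singleton (x n i)) → Γ ⊢ bool ∋ λ n i → S n i (x n i)
  memberᶜ = lookupᶜ falseᶜ

  rowᶜ : ∀ {A : ∀ n → Index Γ n → Relation n} {x : ∀ n → Index Γ n → Fin n} →
         Γ ∋ᵐ A → Γ ∋ᵛ (λ n i → singleton (x n i)) → Γ ∋ᵛ λ n i → A n i (x n i)
  rowᶜ = lookupᶜ nilᶜ

  entryᶜ : ∀ {A : ∀ n → Index Γ n → Relation n} {x y : ∀ n → Index Γ n → Fin n} →
           Γ ∋ᵐ A → Γ ∋ᵛ (λ n i → singleton (x n i)) → Γ ∋ᵛ (λ n i → singleton (y n i)) →
           Γ ⊢ bool ∋ λ n i → A n i (x n i) (y n i)
  entryᶜ {x = x} {y} a cx cy = memberᶜ {x = y} (rowᶜ {x = x} a cx) cy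

fullᶜ : ∀ {Γ} {A : ∀ n → Index Γ n → Relation n} → Γ ∋ᵐ A → Γ ∋ᵛ λ n i → full
fullᶜ a = setᶜ a trueᶜ

emptyᶜ : ∀ {Γ} {A : ∀ n → Index Γ n → Relation n} → Γ ∋ᵐ A → Γ ∋ᵛ λ n i → empty
emptyᶜ a = setᶜ a falseᶜ

module _ {Γ : Env} {A : ∀ n → Index Γ n → Relation n} (a : Γ ∋ᵐ A) where

  growᶜ : ∀ {C S : ∀ n → Index Γ n → VertexSet n} → Γ ∋ᵛ C → Γ ∋ᵛ S → Γ ∋ᵛ
    λ n i → Spanner.grow (A n i) (C n i) (S n i)
  growᶜ c s = setᶜ a (orᶜ (memberᶜ (weaken s) this) (andᶜ (memberᶜ (weaken c) this)
    (existsᶜ (setᶜ (weaken a)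
      (andᶜ (memberᶜ (weaken (weaken s)) this) (memberᶜ (rowᶜ (weaken (weaken a)) (weaken this)) this))))))

module _ {Γ : Env} {A : ∀ n → Index Γ n → Relation n} (a : Γ ∋ᵐ A) where

  componentᶜ : ∀ {C : ∀ n → Index Γ n → VertexSet n} {x : ∀ n → Index Γ n → Fin n} →
               Γ ∋ᵛ C → Γ ∋ᵛ (λ n i → singleton (x n i)) → Γ ∋ᵛ
                 λ n i → Spanner.component (A n i) (C n i) (x n i)
  componentᶜ {C} {x} c s = iterateᶜ (λ n i → tabulate) (λ n i → Spanner.grow (A n i) (C n i)) a
    (setᶜ a (andᶜ (memberᶜ (weaken c) this) (memberᶜ (weaken s) this)))
    (growᶜ (weaken a) (weaken c) (fstᶜ inputᶜ))

module _ {Γ : Env} {A : ∀ n → Index Γ n → Relation n} (a : Γ ∋ᵐ A) where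

  balancedᶜ : ∀ {C S : ∀ n → Index Γ n → VertexSet n} → Γ ∋ᵛ C → Γ ∋ᵛ S →
              Γ ⊢ bool ∋ λ n i → Spanner.balanced (A n i) (C n i) (S n i)
  balancedᶜ c s = notᶜ (existsᶜ (setᶜ a (notᶜ (atMostHalfᶜ
    (componentᶜ (weaken a) {x = λ n → proj₂}
      (setᶜ (weaken a) (andᶜ (memberᶜ (weaken (weaken c)) this)
        (notᶜ (memberᶜ (weaken (weaken s)) this)))) this)
    (weaken c)))))

module _ {Γ : Env} {A : ∀ n → Index Γ n → Relation n} (a : Γ ∋ᵐ A) where

  balancedSetᶜ : ∀ {C : ∀ n → Index Γ n → VertexSet n} {D : ∀ n → Index Γ n → Relation n} → Γ ∋ᵛ C →
    Γ ∋ᵐ D →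
                 Γ ∋ᵛ λ n i v → Spanner.balanced (A n i) (C n i) (D n i v)
  balancedSetᶜ c d = setᶜ a (balancedᶜ (weaken a) (weaken c) (rowᶜ {x = λ n → proj₂} (weaken d) this))

module _ {Γ : Env} {A : ∀ n → Index Γ n → Relation n} (a : Γ ∋ᵐ A) where

  widenᶜ : ∀ {C : ∀ n → Index Γ n → VertexSet n} {D : ∀ n → Index Γ n → Relation n} → Γ ∋ᵛ C → Γ ∋ᵐ D →
           Γ ∋ᵐ λ n i → Spanner.widen (A n i) (C n i) (D n i)
  widenᶜ {C} {D} c d = cast
    (λ n i → sym (if-float {B = List (List Bool)}
      (λ (D : Relation n) → tabulate λ x → tabulate (D x))
        (exists (λ v → Spanner.balanced (A n i) (C n i) (D n i v)))))
    (ifᶜ (existsᶜ (balancedSetᶜ a c d)) d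
      (setᶜ a (growᶜ (weaken a) (fullᶜ (weaken a)) (rowᶜ {x = λ n → proj₂} (weaken d) this))))

module _ {Γ : Env} {A : ∀ n → Index Γ n → Relation n} (a : Γ ∋ᵐ A) where

  disksᶜ : ∀ {C : ∀ n → Index Γ n → VertexSet n} → Γ ∋ᵛ C → Γ ∋ᵐ λ n i → Spanner.disks (A n i) (C n i)
  disksᶜ {C} c = iterateᶜ (λ n i D → tabulate λ x → tabulate (D x))
    (λ n i → Spanner.widen (A n i) (C n i)) a
    (identityᶜ a) (widenᶜ (weaken a) (weaken c) (fstᶜ inputᶜ))

  centreᶜ : ∀ {C : ∀ n → Index Γ n → VertexSet n} → Γ ∋ᵛ C → Γ ∋ᵛ λ n i → Spanner.centre (A n i) (C n i)
  centreᶜ c = chooseSetᶜ (balancedSetᶜ a c (disksᶜ c)) (identityᶜ a) (emptyᶜ a)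

  separatorᶜ : ∀ {C : ∀ n → Index Γ n → VertexSet n} → Γ ∋ᵛ C → Γ ∋ᵛ
    λ n i → Spanner.separator (A n i) (C n i)
  separatorᶜ c = chooseSetᶜ (balancedSetᶜ a c (disksᶜ c)) (disksᶜ c) (emptyᶜ a)

  componentᴺᶜ : ∀ {C : ∀ n → Index Γ n → VertexSet n} {x : ∀ n → Index Γ n → Fin n} →
               Γ ∋ᵛ C → Γ ∋ᵛ (λ n i → singleton (x n i)) → Γ ∋ᵛ
                 λ n i → Spanner.componentᴺ (A n i) (C n i) (x n i)
  componentᴺᶜ {C} {x} c s =
    cast (λ n i → tabulate-cong
      (λ y → sym (lookup∘tabulate (Spanner.component (A n i) (C n i) (x n i)) y)))
        (componentᶜ a {x = x} c s)

module _ {Γ : Env} {A : ∀ n → Index Γ n → Relation n} (a : Γ ∋ᵐ A) where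

  approachᶜ : ∀ {S : ∀ n → Index Γ n → VertexSet n} {x : ∀ n → Index Γ n → Fin n} →
              Γ ∋ᵛ (λ n i → singleton (x n i)) → Γ ∋ᵛ S → Γ ∋ᵛ
                λ n i → Spanner.approach (A n i) (x n i) (S n i)
  approachᶜ {S} {x} cx s = iterateᶜ (λ n i → tabulate)
    (λ n i S → if Spanner.grow (A n i) full S (x n i) then S else Spanner.grow (A n i) full S) a s
    (cast (λ n (i , S) → sym (if-float tabulate (Spanner.grow (A n i) full S (x n i))))
      (ifᶜ (memberᶜ {x = λ n i → x n (proj₁ i)} g (weaken cx)) (fstᶜ inputᶜ) g))
    where g = growᶜ (weaken a) (fullᶜ (weaken a)) (fstᶜ inputᶜ)

module _ {Γ : Env} {A : ∀ n → Index Γ n → Relation n} (a : Γ ∋ᵐ A) where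

  parentᶜ : ∀ {S : ∀ n → Index Γ n → VertexSet n} {x : ∀ n → Index Γ n → Fin n} →
              Γ ∋ᵛ (λ n i → singleton (x n i)) → Γ ∋ᵛ S → Γ ∋ᵛ
                λ n i → Spanner.parent (A n i) (x n i) (S n i)
  parentᶜ {x = x} cx s = chooseSetᶜ
    (setᶜ a (andᶜ (memberᶜ (weaken (approachᶜ a {x = x} cx s)) this)
      (memberᶜ {x = λ n i → x n (proj₁ i)} (rowᶜ {x = λ n → proj₂} (weaken a) this) (weaken cx))))
    (identityᶜ a) (emptyᶜ a)

module _ {Γ : Env} {A : ∀ n → Index Γ n → Relation n} (a : Γ ∋ᵐ A) where

  nextᶜ : ∀ {R : ∀ n → Index Γ n → VertexSet n} → Γ ∋ᵛ R → Γ ∋ᵛ λ n i → Spanner.next (A n i) (R n i)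
  nextᶜ r = setᶜ a (andᶜ (memberᶜ (weaken r) this)
    (notᶜ (memberᶜ (separatorᶜ (weaken a)
      (componentᴺᶜ (weaken a) {x = λ n → proj₂} (weaken r) this)) this)))

  parentEdgesᶜ : ∀ {R : ∀ n → Index Γ n → VertexSet n} → Γ ∋ᵛ R → Γ ∋ᵐ
    λ n i → Spanner.parentEdges (A n i) (R n i)
  parentEdgesᶜ r = setᶜ a (setᶜ (weaken a) (andᶜ (weaken (memberᶜ (weaken r) this))
    (memberᶜ (weaken (parentᶜ (weaken a) {x = λ n → proj₂} this
      (centreᶜ (weaken a) (componentᴺᶜ (weaken a) {x = λ n → proj₂} (weaken r) this)))) this)))

module _ {Γ : Env} {A : ∀ n → Index Γ n → Relation n} (a : Γ ∋ᵐ A) where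

  -- A single loop carries `remaining` and `chosen` together, as each level reads the vertex set
  -- left by the earlier ones.
  chosenᶜ : Γ ∋ᵐ λ n i → Spanner.chosen (A n i) n
  chosenᶜ = sndᶜ {x = λ n i → tabulate (Spanner.remaining (A n i) n)}
    (cast (λ n i → cong (λ (R , H) → tabulate R , tabulate λ x → tabulate (H x)) (levels n i n))
      (iterateᶜ (λ n i (R , H) → tabulate R , tabulate λ x → tabulate (H x)) level a
        (pairᶜ (fullᶜ a) (setᶜ a (emptyᶜ (weaken a))))
        (pairᶜ (nextᶜ (weaken a) (fstᶜ (fstᶜ inputᶜ)))
          (setᶜ (weaken a) (setᶜ (weaken (weaken a))
            (orᶜ (entryᶜ {x = λ n i → proj₂ (proj₁ i)} {λ n → proj₂}
              (weaken (weaken (sndᶜ (fstᶜ inputᶜ)))) (weaken this) this)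
                (entryᶜ {x = λ n i → proj₂ (proj₁ i)} {λ n → proj₂}
                  (weaken (weaken (parentEdgesᶜ (weaken a) (fstᶜ (fstᶜ inputᶜ))))) (weaken this) this)))))))
    where
    level : ∀ n i → VertexSet n × Relation n → VertexSet n × Relation n
    level n i (R , H) = Spanner.next (A n i) R , λ x y → H x y ∨ Spanner.parentEdges (A n i) R x y

    levels : ∀ n i k → iterate k (level n i) (full , λ _ → empty)
      ≡ (Spanner.remaining (A n i) k , Spanner.chosen (A n i) k)
    levels n i zero    = refl
    levels n i (suc k) = cong (level n i) (levels n i k)

module _ {Γ : Env} {A : ∀ n → Index Γ n → Relation n} (a : Γ ∋ᵐ A) where

  spannerᶜ : Γ ∋ᵐ λ n i → Spanner.spanner (A n i)
  spannerᶜ = setᶜ a (setᶜ (weaken a)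
    (orᶜ (entryᶜ {x = λ n i → proj₂ (proj₁ i)} {λ n → proj₂} (weaken (weaken (chosenᶜ a)))
      (weaken this) this)
         (entryᶜ {x = λ n → proj₂} {λ n i → proj₂ (proj₁ i)} (weaken (weaken (chosenᶜ a))) this
           (weaken this))))

-- Vertex sets and reachability

_⊆_ : VertexSet n → VertexSet n → Set
S ⊆ C = ∀ y → T (S y) → T (C y)

infix 4 _⊆_

not⁺ : ∀ {b} → ¬ T b → T (not b)
not⁺ {true}  h = ⊥-elim (h _)
not⁺ {false} h = _

not⁻ : ∀ {b} → T (not b) → ¬ T b
not⁻ {false} _ ()

singleton⁺ : (x : Fin n) → T (singleton x x)
singleton⁺ x with x ≟ x
... | yes _  = _
... | no x≢x = ⊥-elim (x≢x refl)

singleton⁻ : {x y : Fin n} → T (singleton x y) → x ≡ y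
singleton⁻ {x = x} {y} t with x ≟ y
... | yes eq = eq

exists⁺ : {S : VertexSet n} (x : Fin n) → T (S x) → T (exists S)
exists⁺ {n} {S} x Sx = go (allFin n) (∈-allFin x)
  where
  go : ∀ js → x ∈ js → T (foldr (λ j b → S j ∨ b) false js)
  go (j ∷ js) (here refl) = from T-∨ (inj₁ Sx)
  go (j ∷ js) (there x∈)  = from (T-∨ {S j}) (inj₂ (go js x∈))

exists⁻ : {S : VertexSet n} → T (exists S) → ∃[ x ] T (S x)
exists⁻ {n} {S} = go (allFin n)
  where
  go : ∀ js → T (foldr (λ j b → S j ∨ b) false js) → ∃[ x ] T (S x)
  go (j ∷ js) t with to (T-∨ {S j}) t
  ... | inj₁ Sj = j , Sj
  ... | inj₂ t′ = go js t′

-- The selected `j` depends on `b` alone, hence the inner quantification over `X` and `f`: one `j`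
-- describes both `centre` and `separator`.
choose-spec : (b : VertexSet n) →
  (∃[ j ] T (b j) × (∀ {X : Set} (f : Fin n → X) d → choose b f d ≡ f j)) ⊎
  ((∀ j → ¬ T (b j)) × (∀ {X : Set} (f : Fin n → X) d → choose b f d ≡ d))
choose-spec {n} b = map₂ˢ (λ (h , e) → (λ j → h j (∈-allFin j)) , λ {X} → e {X}) (go (allFin n))
  where
  go : ∀ js →
    (∃[ j ] T (b j) × (∀ {X : Set} (f : Fin n → X) d → foldr (λ j x → if b j then f j else x) d js ≡ f j)) ⊎
    ((∀ j → j ∈ js → ¬ T (b j))
      × (∀ {X : Set} (f : Fin n → X) d → foldr (λ j x → if b j then f j else x) d js ≡ d))
  go [] = inj₂ ((λ _ ()) , λ _ _ → refl)
  go (j ∷ js) with b j in eq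
  ... | true  = inj₁ (j , subst T (sym eq) _ , λ _ _ → refl)
  ... | false with go js
  ...   | inj₁ r       = inj₁ r
  ...   | inj₂ (h , e) = inj₂ ((λ { j (here refl) → subst T eq ; j (there j∈) → h j j∈ }) , e)

countIn : VertexSet n → List (Fin n) → ℕ
countIn S = foldr (λ j m → if S j then suc m else m) 0

countIn-mono : {S C : VertexSet n} → S ⊆ C → ∀ js → countIn S js ≤ countIn C js
countIn-mono S⊆C [] = z≤n
countIn-mono {S = S} {C} S⊆C (j ∷ js) with S j | C j | S⊆C j
... | true  | true  | _ = s≤s (countIn-mono S⊆C js)
... | true  | false | h = ⊥-elim (h _)
... | false | true  | _ = m≤n⇒m≤1+n (countIn-mono S⊆C js)
... | false | false | _ = countIn-mono S⊆C js

count-mono : {S C : VertexSet n} → S ⊆ C → count S ≤ count C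
count-mono S⊆C = countIn-mono S⊆C (allFin _)

count-strict : {S C : VertexSet n} → S ⊆ C → ∀ x → T (C x) → ¬ T (S x) → count S < count C
count-strict {n} {S} {C} S⊆C x Cx ¬Sx = go (allFin n) (∈-allFin x)
  where
  go : ∀ js → x ∈ js → countIn S js < countIn C js
  go (j ∷ js) (here refl) with S j | C j
  ... | true  | _    = ⊥-elim (¬Sx _)
  ... | false | true = s≤s (countIn-mono S⊆C js)
  go (j ∷ js) (there x∈) with S j | C j | S⊆C j
  ... | true  | true  | _ = s≤s (go js x∈)
  ... | true  | false | h = ⊥-elim (h _)
  ... | false | true  | _ = m≤n⇒m≤1+n (go js x∈)
  ... | false | false | _ = go js x∈

count≤ : (S : VertexSet n) → count S ≤ n
count≤ {n} S = subst (count S ≤_) (length-tabulate {n = n} id) (go (allFin n))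
  where
  go : ∀ js → countIn S js ≤ length js
  go [] = z≤n
  go (j ∷ js) with S j
  ... | true  = s≤s (go js)
  ... | false = m≤n⇒m≤1+n (go js)

count-all : {S : VertexSet n} → n ≤ count S → ∀ x → T (S x)
count-all {S = S} n≤ x with T? (S x)
... | yes Sx = Sx
... | no ¬Sx = contradiction (≤-trans (count-strict (λ _ _ → _) x _ ¬Sx) (count≤ full)) (≤⇒≯ n≤)

count-disjoint : {S S′ C : VertexSet n} → S ⊆ C → S′ ⊆ C → (∀ x → T (S x) → ¬ T (S′ x)) →
                 count S + count S′ ≤ count C
count-disjoint {n} {S} {S′} {C} S⊆C S′⊆C disj = go (allFin n)
  where
  go : ∀ js → countIn S js + countIn S′ js ≤ countIn C js
  go [] = z≤n
  go (j ∷ js) with S j | S′ j | C j | S⊆C j | S′⊆C j | disj j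
  ... | true  | true  | _     | _ | _ | d = ⊥-elim (d _ _)
  ... | true  | false | true  | _ | _ | _ = s≤s (go js)
  ... | true  | false | false | h | _ | _ = ⊥-elim (h _)
  ... | false | true  | true  | _ | _ | _ =
    subst (_≤ suc (countIn C js)) (sym (+-suc (countIn S js) (countIn S′ js))) (s≤s (go js))
  ... | false | true  | false | _ | h | _ = ⊥-elim (h _)
  ... | false | false | true  | _ | _ | _ = m≤n⇒m≤1+n (go js)
  ... | false | false | false | _ | _ | _ = go js

count-positive : {S : VertexSet n} → 0 < count S → ∃[ x ] T (S x)
count-positive {n} {S} lt with T? (exists S)
... | yes t = exists⁻ t
... | no ¬t = contradiction lt
  (≤⇒≯ (subst (count S ≤_) (go (allFin n)) (count-mono {S = S} {empty} λ y Sy → ¬t (exists⁺ {S = S} y Sy))))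
  where
  go : ∀ js → countIn (empty {n}) js ≡ 0
  go []       = refl
  go (j ∷ js) = go js

count-pair : {S : VertexSet n} (x y : Fin n) → T (S x) → T (S y) → x ≢ y → 2 ≤ count S
count-pair {S = S} x y Sx Sy x≢y = ≤-trans
  (s≤s (≤-trans (s≤s z≤n) (count-strict {S = empty} {singleton x} (λ _ ()) x (singleton⁺ x) λ ())))
  (count-strict {S = singleton x} (λ z t → subst (T ∘ S) (singleton⁻ t) Sx) y Sy (x≢y ∘ singleton⁻))

atMostHalf-∸ : (S C : VertexSet n) →
  foldr (λ j m → if S j then pred (pred m) else m) (suc (count C)) (allFin n) ≡ suc (count C) ∸ 2 * count S
atMostHalf-∸ {n} S C = go (allFin n)
  where
  go : ∀ js → foldr (λ j m → if S j then pred (pred m) else m) (suc (count C)) js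
    ≡ suc (count C) ∸ 2 * countIn S js
  go [] = refl
  go (j ∷ js) with S j
  ... | false = go js
  ... | true  = begin
    pred (pred (foldr (λ j m → if S j then pred (pred m) else m) (suc (count C)) js))
      ≡⟨ cong (pred ∘ pred) (go js) ⟩
    pred (pred (suc (count C) ∸ 2 * k))       ≡⟨ cong pred (pred[m∸n]≡m∸[1+n] (suc (count C)) (2 * k)) ⟩
    pred (suc (count C) ∸ suc (2 * k))        ≡⟨ pred[m∸n]≡m∸[1+n] (suc (count C)) (suc (2 * k)) ⟩
    suc (count C) ∸ suc (suc (2 * k))         ≡⟨ cong (suc (count C) ∸_) (*-suc 2 k) ⟨
    suc (count C) ∸ 2 * suc k                 ∎
    where
    open ≡-Reasoning
    k = countIn S js

atMostHalf⁺ : {S C : VertexSet n} → 2 * count S ≤ count C → T (atMostHalf S C)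
atMostHalf⁺ {S = S} {C} le = <⇒<ᵇ (subst (0 <_) (sym (atMostHalf-∸ S C)) (m<n⇒0<n∸m (s≤s le)))

atMostHalf⁻ : {S C : VertexSet n} → T (atMostHalf S C) → 2 * count S ≤ count C
atMostHalf⁻ {S = S} {C} t = ≤-pred (m∸n≢0⇒n<m (≢-sym (<⇒≢ (subst (0 <_) (atMostHalf-∸ S C) (<ᵇ⇒< 0 _ t)))))

-- Walks with an upper bound on the length, since these concatenate freely; simple paths and exact
-- distances return in `within⇒distance`.
Within : (Fin n → Fin n → Set) → Fin n → Fin n → ℕ → Set
Within R a b k = ∃[ w ] ∣_∣ʷ {R = R} {a} {b} w ≤ k

∣◅◅∣ : {R : Fin n → Fin n → Set} {a b c : Fin n} (w : Star R a b) (w′ : Star R b c) →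
      ∣ w ◅◅ w′ ∣ʷ ≡ ∣ w ∣ʷ + ∣ w′ ∣ʷ
∣◅◅∣ ε       w′ = refl
∣◅◅∣ (_ ◅ w) w′ = cong suc (∣◅◅∣ w w′)

module _ {R : Fin n → Fin n → Set} where

  within-trans : ∀ {a b c k l} → Within R a b k → Within R b c l → Within R a c (k + l)
  within-trans (w , p) (w′ , p′) = w ◅◅ w′ , ≤-trans (≤-reflexive (∣◅◅∣ w w′)) (+-mono-≤ p p′)

  within-relax : ∀ {a b k l} → k ≤ l → Within R a b k → Within R a b l
  within-relax k≤l (w , p) = w , ≤-trans p k≤l

  within-sym : (∀ {a b} → R a b → R b a) → ∀ {a b k} → Within R a b k → Within R b a k
  within-sym s {k = k} (w , p) = go w k p
    where
    go : ∀ {a b} (w : Star R a b) k → ∣ w ∣ʷ ≤ k → Within R b a k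
    go ε       k       p       = ε , z≤n
    go (r ◅ w) (suc k) (s≤s p) =
      within-relax (≤-reflexive (+-comm k 1)) (within-trans (go w k p) (s r ◅ ε , s≤s z≤n))

Inside : VertexSet n → (Fin n → Fin n → Set) → Fin n → Fin n → Set
Inside C R a b = R a b × T (C a) × T (C b)

module Growth (G : Graph n) where

  open Spanner (adj G) public

  grow-⊇ : ∀ C S → S ⊆ grow C S
  grow-⊇ C S y t = from T-∨ (inj₁ t)

  grow⁺ : ∀ C S {x y} → T (C y) → T (S x) → Adj G y x → T (grow C S y)
  grow⁺ C S {x} {y} Cy Sx yx = from (T-∨ {S y}) (inj₂ (from T-∧ (Cy , exists⁺ x (from T-∧ (Sx , yx)))))

  grow⁻ : ∀ C S {y} → T (grow C S y) → T (S y) ⊎ (T (C y) × ∃[ x ] T (S x) × Adj G y x)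
  grow⁻ C S {y} t with to (T-∨ {S y}) t
  ... | inj₁ Sy = inj₁ Sy
  ... | inj₂ t′ = let Cy , e = to (T-∧ {C y}) t′ ; x , p = exists⁻ e in inj₂ (Cy , x , to T-∧ p)

  grow-mono : ∀ C {S S′} → S ⊆ S′ → grow C S ⊆ grow C S′
  grow-mono C {S} {S′} h y t with grow⁻ C S t
  ... | inj₁ Sy                = grow-⊇ C S′ y (h y Sy)
  ... | inj₂ (Cy , x , Sx , a) = grow⁺ C S′ Cy (h x Sx) a

  grows : VertexSet n → VertexSet n → ℕ → VertexSet n
  grows C S k = iterate k (grow C) S

  grows-mono : ∀ C S {k l} → k ≤ l → grows C S k ⊆ grows C S l
  grows-mono C S {k} {l} k≤l = subst (λ m → grows C S k ⊆ grows C S m) (m∸n+n≡m k≤l) (go (l ∸ k))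
    where
    go : ∀ d → grows C S k ⊆ grows C S (d + k)
    go zero    y t = t
    go (suc d) y t = grow-⊇ C _ y (go d y t)

  -- Each round that is not already stable adds a vertex.
  grows-stable : ∀ C S → grow C (grows C S n) ⊆ grows C S n
  grows-stable C S = finish (go n)
    where
    go : ∀ k → (grow C (grows C S k) ⊆ grows C S k) ⊎ k ≤ count (grows C S k)
    go zero = inj₂ z≤n
    go (suc k) with go k
    ... | inj₁ h = inj₁ (grow-mono C h)
    ... | inj₂ k≤ with T? (exists (grow C (grows C S k) ∖ grows C S k))
    ...   | yes t = let x , p = exists⁻ t ; q , r = to (T-∧ {grow C (grows C S k) x}) p in
                    inj₂ (≤-trans (s≤s k≤) (count-strict (grow-⊇ C (grows C S k)) x q (not⁻ r)))
    ...   | no ¬t = inj₁ (grow-mono C λ y t → stable y t (T? (grows C S k y)))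
      where
      stable : ∀ y → T (grow C (grows C S k) y) → _ → T (grows C S k y)
      stable y t (yes p) = p
      stable y t (no ¬p) = ⊥-elim (¬t (exists⁺ y (from T-∧ (t , not⁺ ¬p))))
    finish : (grow C (grows C S n) ⊆ grows C S n) ⊎ n ≤ count (grows C S n) →
      grow C (grows C S n) ⊆ grows C S n
    finish (inj₁ h)  = h
    finish (inj₂ n≤) = λ y _ → count-all n≤ y

  disk : ℕ → Fin n → VertexSet n
  disk k v = grows full (singleton v) k

  disk⁻ : ∀ k {v y} → T (disk k v y) → Within (Adj G) y v k
  disk⁻ zero {v} {y} t with refl ← singleton⁻ {x = v} {y} t = ε , z≤n
  disk⁻ (suc k) t with grow⁻ full _ t
  ... | inj₁ t′               = within-relax (n≤1+n k) (disk⁻ k t′)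
  ... | inj₂ (_ , x , t′ , a) = within-trans (a ◅ ε , s≤s z≤n) (disk⁻ k t′)

  disk⁺ : ∀ k {v y} → Within (Adj G) y v k → T (disk k v y)
  disk⁺ k       {v} (ε , _)           = grows-mono full (singleton v) {0} {k} z≤n v (singleton⁺ v)
  disk⁺ (suc k) {v} (a ◅ w , s≤s p)   = grow⁺ full _ _ (disk⁺ k (w , p)) a

  -- After n rounds the disk is closed under adjacency, so the length of the walk does not matter.
  disk-n : ∀ {v y} → Walk G y v → T (disk n v y)
  disk-n {v} ε       = disk⁺ n (ε , z≤n)
  disk-n {v} (a ◅ w) = grows-stable full (singleton v) _ (grow⁺ full _ _ (disk-n w) a)

  component⁻ : ∀ C {x y} → T (component C x y) → T (C x) × T (C y) × Star (Inside C (Adj G)) y x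
  component⁻ C {x} = go n
    where
    go : ∀ k {y} → T (grows C (λ y → C y ∧ singleton x y) k y) →
      T (C x) × T (C y) × Star (Inside C (Adj G)) y x
    go zero {y} t with Cy , e ← to (T-∧ {C y}) t with refl ← singleton⁻ {x = x} {y} e = Cy , Cy , ε
    go (suc k) t with grow⁻ C _ t
    ... | inj₁ t′ = go k t′
    ... | inj₂ (Cy , z , t′ , a) = let Cx , Cz , w = go k t′ in Cx , Cy , (a , Cy , Cz) ◅ w

  component⁺ : ∀ C {x y} → T (C x) → Star (Inside C (Adj G)) y x → T (component C x y)
  component⁺ C {x} Cx ε = grows-mono C _ {0} {n} z≤n x (from T-∧ (Cx , singleton⁺ x))
  component⁺ C Cx ((a , Cy , _) ◅ w) = grows-stable C _ _ (grow⁺ C _ Cy (component⁺ C Cx w) a)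

  component-mono : ∀ {C C′} → C ⊆ C′ → ∀ x → component C x ⊆ component C′ x
  component-mono {C} {C′} h x y t = let Cx , _ , w = component⁻ C t in component⁺ C′ (h x Cx) (go w)
    where
    go : ∀ {a b} → Star (Inside C (Adj G)) a b → Star (Inside C′ (Adj G)) a b
    go ε = ε
    go ((a , p , q) ◅ w) = (a , h _ p , h _ q) ◅ go w

  balanced⁺ : ∀ C S → (∀ x → 2 * count (component (C ∖ S) x) ≤ count C) → T (balanced C S)
  balanced⁺ C S h = not⁺ λ t → let x , p = exists⁻ t
                               in not⁻ p (atMostHalf⁺ {S = component (C ∖ S) x} {C} (h x))

  balanced⁻ : ∀ C S → T (balanced C S) → ∀ x → 2 * count (component (C ∖ S) x) ≤ count C
  balanced⁻ C S t x with T? (atMostHalf (component (C ∖ S) x) C)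
  ... | yes p = atMostHalf⁻ {S = component (C ∖ S) x} {C} p
  ... | no ¬p = ⊥-elim (not⁻ t (exists⁺ x (not⁺ ¬p)))

  ∖-antitone : ∀ (C : VertexSet n) {S S′} → S ⊆ S′ → C ∖ S′ ⊆ C ∖ S
  ∖-antitone C {S} {S′} h y t = let Cy , ¬S′y = to (T-∧ {C y}) t
                                in from (T-∧ {C y}) (Cy , not⁺ (not⁻ {S′ y} ¬S′y ∘ h y))

  -- Removing more leaves smaller components. This allows passing from a bag to a disk around it and
  -- from a disk to a larger one.
  balanced-mono : ∀ C {S S′} → S ⊆ S′ → T (balanced C S) → T (balanced C S′)
  balanced-mono C {S} {S′} h t = balanced⁺ C S′ λ x →
    ≤-trans (*-monoʳ-≤ 2 (count-mono (component-mono {C ∖ S′} {C ∖ S} (∖-antitone C {S} {S′} h) x)))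
      (balanced⁻ C S t x)

-- A bag that separates evenly

unique-lookup : {A : Set} {xs : List A} → Unique xs → ∀ {i j} → lookup xs i ≡ lookup xs j → i ≡ j
unique-lookup (_ ∷ _)  {zero}  {zero}  eq = refl
unique-lookup {xs = _ ∷ xs} (x ∷ _)  {zero}  {suc j} eq = ⊥-elim (All.lookup x (∈-lookup {xs = xs} j) eq)
unique-lookup {xs = _ ∷ xs} (x ∷ _)  {suc i} {zero}  eq =
  ⊥-elim (All.lookup x (∈-lookup {xs = xs} i) (sym eq))
unique-lookup (_ ∷ xs) {suc i} {suc j} eq = cong suc (unique-lookup xs eq)

unique-length : {xs : List (Fin n)} → Unique xs → length xs ≤ n
unique-length u = injective⇒≤ (unique-lookup u)

module _ {R : Fin n → Fin n → Set} where

  open DecMembership (_≟_ {n}) using (_∈?_)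

  length-vertices : ∀ {u v} (w : Star R u v) → length (vertices w) ≡ suc ∣ w ∣ʷ
  length-vertices ε       = refl
  length-vertices (_ ◅ w) = cong suc (length-vertices w)

  suffix : ∀ {u v x} (w : Star R u v) → Unique (vertices w) → x ∈ vertices w →
           Σ (Star R x v) λ w′ → Unique (vertices w′) × ∣ w′ ∣ʷ ≤ ∣ w ∣ʷ
  suffix ε       un       (here refl) = ε , un , z≤n
  suffix (r ◅ w) un       (here refl) = r ◅ w , un , ≤-refl
  suffix (r ◅ w) (_ ∷ un) (there x∈)  = let w′ , un′ , le = suffix w un x∈ in w′ , un′ , m≤n⇒m≤1+n le

  prefix : ∀ {u v x} (w : Star R u v) → Unique (vertices w) → x ∈ vertices w →
           Σ (Star R u x) λ w′ → Unique (vertices w′) × (∀ {y} → y ∈ vertices w′ → y ∈ vertices w)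
  prefix ε       un       (here refl) = ε , un , id
  prefix (r ◅ w) un       (here refl) = ε , [] ∷ [] , λ { (here refl) → here refl }
  prefix (r ◅ w) (u∉ ∷ un) (there x∈) with w′ , un′ , sub ← prefix w un x∈ =
    r ◅ w′ , All.tabulate (λ y∈ → All.lookup u∉ (sub y∈)) ∷ un′ ,
      λ { (here eq) → here eq ; (there y∈) → there (sub y∈) }

  simplify : ∀ {u v} (w : Star R u v) → Σ (Star R u v) λ w′ → Unique (vertices w′) × ∣ w′ ∣ʷ ≤ ∣ w ∣ʷ
  simplify ε = ε , [] ∷ [] , z≤n
  simplify {u} (r ◅ w) with w′ , un , le ← simplify w with u ∈? vertices w′
  ... | yes u∈ = let w″ , un″ , le″ = suffix w′ un u∈ in w″ , un″ , m≤n⇒m≤1+n (≤-trans le″ le)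
  ... | no  u∉ = r ◅ w′ , ¬Any⇒All¬ _ u∉ ∷ un , s≤s le

vertices-gmap : {R S : Fin n → Fin n → Set} (f : ∀ {a b} → R a b → S a b) → ∀ {u v} (w : Star R u v) →
                (vertices (gmap id f w) ≡ vertices w) × (∣ gmap id f w ∣ʷ ≡ ∣ w ∣ʷ)
vertices-gmap f ε       = refl , refl
vertices-gmap f {u} (r ◅ w) = let p , q = vertices-gmap f w in cong (u ∷_) p , cong suc q

module _ {m} (G : Graph m) where

  private
    symm : ∀ {u v} → Adj G u v → Adj G v u
    symm {u} {v} = subst T (Graph.sym G u v)

    loopless : ∀ {u} → ¬ Adj G u u
    loopless {u} a = subst T (Graph.irrefl G u) a

  Avoiding : Fin m → Fin m → Fin m → Set
  Avoiding i a b = Adj G a b × a ≢ i × b ≢ i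

  avoiding-sym : ∀ {i a b} → Avoiding i a b → Avoiding i b a
  avoiding-sym (r , p , q) = symm r , q , p

  -- The first walk never enters `i` and the second never steps out of `j`, so their concatenation
  -- does not use the step from `j` to `i`. Made simple, it is a path with at least two edges, which
  -- the edge `ij` closes to a cycle.
  acyclic⇒bridge : Acyclic G → ∀ {i j k} → Adj G i j →
                   Star (Avoiding i) j k → Star (Avoiding j) k i → ⊥
  acyclic⇒bridge acyclic {i} {j} ij w₁ w₂ = acyclic j i path (long w un) ij
    where
    R : Fin m → Fin m → Set
    R a b = Adj G a b × ¬ (a ≡ j × b ≡ i)

    simple = simplify (gmap id (λ (r , _ , b≢i) → r , b≢i ∘ proj₂) w₁
      ◅◅ gmap {U = R} id (λ (r , a≢j , _) → r , a≢j ∘ proj₁) w₂)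
    w  = proj₁ simple
    un = proj₁ (proj₂ simple)

    path : Path G j i
    path = record
      { walk = gmap id proj₁ w ; distinct = subst Unique (sym (proj₁ (vertices-gmap proj₁ w))) un }

    long : ∀ (w : Star R j i) → Unique (vertices w) → 2 ≤ ∣ gmap {U = Adj G} id proj₁ w ∣ʷ
    long ε                 _ = ⊥-elim (loopless ij)
    long ((_ , h) ◅ ε)     _ = ⊥-elim (h (refl , refl))
    long (_ ◅ _ ◅ _)       _ = s≤s (s≤s z≤n)

  -- Otherwise an orbit of f would close up to a cycle.
  acyclic⇒2-periodic : Acyclic G → (f : Fin m → Fin m) → (∀ i → Adj G i (f i)) → Fin m → ∃[ i ] f (f i) ≡ i
  acyclic⇒2-periodic acyclic f adj-f i₀ = finish (orbit m i₀)
    where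
    R : Fin m → Fin m → Set
    R i j = j ≡ f i

    orbit : ∀ k i → ∃[ j ] Σ (Star R i j) λ w → ∣ w ∣ʷ ≡ k
    orbit zero    i = i , ε , refl
    orbit (suc k) i = let j , w , eq = orbit k (f i) in j , refl ◅ w , cong suc eq

    edge : ∀ {i j} → R i j → Adj G i j
    edge {i} refl = adj-f i

    open DecMembership (_≟_ {m}) using (_∈?_)

    scan : ∀ {u v} (w : Star R u v) → (∃[ i ] f (f i) ≡ i) ⊎ Unique (vertices w)
    scan ε = inj₂ ([] ∷ [])
    scan {u} (_◅_ {j = u′} r w) with scan w
    ... | inj₁ p = inj₁ p
    ... | inj₂ un with u ∈? vertices w
    ...   | no  u∉ = inj₂ (¬Any⇒All¬ _ u∉ ∷ un)
    -- The orbit returns to `u`: after no further step there would be a loop, after one step `f` has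
    -- period 2, and a longer return is a cycle closed by the edge of `r`.
    ...   | yes u∈ with prefix w un u∈
    ...     | ε            , _   , _ = ⊥-elim (loopless (edge r))
    ...     | q ◅ ε        , _   , _ = inj₁ (u , trans (cong f (sym r)) (sym q))
    ...     | q ◅ q′ ◅ w′  , un′ , _ = ⊥-elim (acyclic u′ u
              (record
                { walk = gmap id edge c
                ; distinct = subst Unique (sym (proj₁ (vertices-gmap edge c))) un′ })
              (s≤s (s≤s z≤n)) (edge r))
      where c = q ◅ q′ ◅ w′

    finish : ∃[ j ] Σ (Star R i₀ j) (λ w → ∣ w ∣ʷ ≡ m) → ∃[ i ] f (f i) ≡ i
    finish (j , w , eq) with scan w
    ... | inj₁ p  = p
    -- An orbit of m steps lists m + 1 nodes, too many to be distinct.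
    ... | inj₂ un = contradiction
      (subst (_≤ m) (trans (length-vertices w) (cong suc eq)) (unique-length un)) (<-irrefl refl)

walk-inside : ∀ {n} {G : Graph n} {S : Fin n → Set} → ∀ {u v} (w : Walk G u v) → All S (vertices w) →
              Star (λ a b → Adj G a b × S a × S b) u v
walk-inside ε _ = ε
walk-inside (a ◅ ε) (s ∷ s′ ∷ []) = (a , s , s′) ◅ ε
walk-inside {G = G} (a ◅ b ◅ w) (s ∷ s′ ∷ ss) = (a , s , s′) ◅ walk-inside {G = G} (b ◅ w) (s′ ∷ ss)

module _ {n} {G : Graph n} (D : TreeDecomposition G) where

  open TreeDecomposition D
  open Growth G

  bagSet : Fin nodes → VertexSet n
  bagSet i = Vec.lookup (bag i)

  bagSet⁺ : ∀ {i x} → x Subset.∈ bag i → T (bagSet i x)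
  bagSet⁺ x∈ = from T-≡ ([]=⇒lookup x∈)

  bagSet⁻ : ∀ {i x} → T (bagSet i x) → x Subset.∈ bag i
  bagSet⁻ {i} {x} t = lookup⇒[]= x (bag i) (to T-≡ t)

  -- The nodes whose bags contain `x` induce a subtree, and `i` is not among them.
  subtree-avoids : ∀ {i k l x} → ¬ T (bagSet i x) → x Subset.∈ bag k → x Subset.∈ bag l →
    Star (Avoiding tree i) k l
  subtree-avoids {i} {k} {l} {x} x∉ x∈k x∈l = let p , all = subtrees x k l x∈k x∈l in
    gmap id (λ (a , p , q) → a , (λ { refl → x∉ (bagSet⁺ p) }) , λ { refl → x∉ (bagSet⁺ q) })
      (walk-inside {G = tree} {S = λ h → x Subset.∈ bag h} (walk p) all)

  -- Every edge of the walk lies in a common bag, where the subtrees of its two ends overlap. Hence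
  -- all bags meeting one component of the rest of `C` lie in one branch of the tree at `i`.
  connected-avoids : ∀ {C i k l x y} → ¬ T (bagSet i x) → Star (Inside (C ∖ bagSet i) (Adj G)) x y →
                     x Subset.∈ bag k → y Subset.∈ bag l → Star (Avoiding tree i) k l
  connected-avoids x∉ ε x∈k y∈l = subtree-avoids x∉ x∈k y∈l
  connected-avoids {C} {i} {x = x} x∉ (_◅_ {j = z} (a , _ , z∈) w) x∈k y∈l =
    let h , x∈h , z∈h = coversEdges x z a in
    subtree-avoids x∉ x∈k x∈h ◅◅ connected-avoids {C} (not⁻ (proj₂ (to (T-∧ {C z}) z∈))) w z∈h y∈l

  module _ (C : VertexSet n) where

    Heavy : Fin nodes → Fin n → Set
    Heavy i x = count C < 2 * count (component (C ∖ bagSet i) x)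

    heavy : ∀ i → ¬ T (balanced C (bagSet i)) → ∃[ x ] Heavy i x
    heavy i h with T? (exists λ x → not (atMostHalf (component (C ∖ bagSet i) x) C))
    ... | yes t = let x , p = exists⁻ t
                  in x , ≰⇒> λ le → not⁻ p (atMostHalf⁺ {S = component (C ∖ bagSet i) x} {C} le)
    ... | no ¬t = ⊥-elim (h (not⁺ ¬t))

    outside : ∀ {i x y} → T (component (C ∖ bagSet i) x y) → ¬ T (bagSet i y)
    outside {i} {x} {y} t = let _ , y∈ , _ = component⁻ _ {x} t in not⁻ (proj₂ (to (T-∧ {C y}) y∈))

    inside : ∀ {i x y} → T (component (C ∖ bagSet i) x y) → T (C y)
    inside {i} {x} {y} t = let _ , y∈ , _ = component⁻ _ {x} t in proj₁ (to (T-∧ {C y}) y∈)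

    -- The neighbour of `i` through which all bags meeting the component of `x` are reached.
    Next : ∀ i → Fin n → Set
    Next i x = ∃[ j ] Adj tree i j ×
      (∀ {y l} → T (component (C ∖ bagSet i) x y) → y Subset.∈ bag l → Star (Avoiding tree i) j l)

    -- A heavy component is nonempty. The tree path from `i` to a bag containing one of its vertices
    -- has a first edge, as that vertex is not in the bag of `i`, and this edge gives the direction.
    toward : ∀ {i x} → Heavy i x → Next i x
    toward {i} {x} h
      with y₀ , t₀ ← count-positive {S = component (C ∖ bagSet i) x}
        (*-cancelˡ-< 2 0 _ (≤-trans (s≤s z≤n) h))
      with k , y₀∈k ← coversVerts y₀
      with record { walk = w ; distinct = un } ← proj₁ isTree i k
      = first w un
      where
      from-k : ∀ {y l} → T (component (C ∖ bagSet i) x y) → y Subset.∈ bag l → Star (Avoiding tree i) k l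
      from-k t y∈l =
        connected-avoids {C} (outside {x = x} t₀)
          (proj₂ (proj₂ (component⁻ _ {x} t₀))
            ◅◅ reverseStar (λ (a , p , q) → subst T (Graph.sym G _ _) a , q , p)
              (proj₂ (proj₂ (component⁻ _ {x} t))))
          y₀∈k y∈l

      avoid : ∀ {a} (w : Walk tree a k) → i ∉ vertices w → Star (Avoiding tree i) a k
      avoid w i∉ = gmap id (λ { (a , p , q) → a , ≢-sym p , ≢-sym q })
        (walk-inside {G = tree} w (¬Any⇒All¬ _ i∉))

      first : (w : Walk tree i k) → Unique (vertices w) → ∃[ j ] Adj tree i j ×
        (∀ {y l} → T (component (C ∖ bagSet i) x y) → y Subset.∈ bag l → Star (Avoiding tree i) j l)
      first ε       _        = ⊥-elim (outside {x = x} t₀ (bagSet⁺ y₀∈k))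
      first (a ◅ w) (i∉ ∷ _) = _ , a , λ t y∈l → avoid w (All¬⇒¬Any i∉) ◅◅ from-k t y∈l

    heavy-intersect : ∀ {i j x y} → Heavy i x → Heavy j y →
      ∃[ z ] T (component (C ∖ bagSet i) x z) × T (component (C ∖ bagSet j) y z)
    heavy-intersect {i} {j} {x} {y} h h′ = decide (T? (exists common))
      where
      K K′ common : VertexSet n
      K  = component (C ∖ bagSet i) x
      K′ = component (C ∖ bagSet j) y
      common z = K z ∧ K′ z

      open ≤-Reasoning

      decide : Dec (T (exists common)) → ∃[ z ] T (K z) × T (K′ z)
      decide (yes t) = let z , p = exists⁻ {S = common} t in z , to (T-∧ {K z}) p
      decide (no ¬t) = contradiction (+-mono-< h h′) (≤⇒≯ (begin
        2 * count K + 2 * count K′ ≡⟨ *-distribˡ-+ 2 (count K) (count K′) ⟨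
        2 * (count K + count K′)   ≤⟨ *-monoʳ-≤ 2 disjoint ⟩
        2 * count C                ≡⟨ cong (count C +_) (+-identityʳ (count C)) ⟩
        count C + count C          ∎))
        where
        disjoint = count-disjoint {S = K} {K′} {C} (λ z → inside {i} {x}) (λ z → inside {j} {y})
                     λ z p q → ¬t (exists⁺ {S = common} z (from (T-∧ {K z}) (p , q)))

    -- If `i` and `j` pointed at each other, a bag containing a common vertex of their heavy
    -- components would be joined to `j` avoiding `i` and to `i` avoiding `j`, although the edge
    -- between them is a bridge.
    not-opposed : (h : ∀ i → ∃[ x ] Heavy i x) (next-bag : ∀ i → Next i (proj₁ (h i))) →
                  ∀ i → proj₁ (next-bag (proj₁ (next-bag i))) ≢ i
    not-opposed h next-bag i eq with next-bag i
    ... | j , ij , i-avoids with next-bag j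
    ... | k , _ , j-avoids with refl ← eq
      with z , p , q ← heavy-intersect {k} {j} {proj₁ (h k)} {proj₁ (h j)} (proj₂ (h k))
        (proj₂ (h j)) with l , z∈l ← coversVerts z =
      acyclic⇒bridge tree (proj₂ isTree) ij (i-avoids p z∈l)
        (reverseStar (avoiding-sym tree) (j-avoids q z∈l))

    balanced-bag : Fin n → ∃[ i ] T (balanced C (bagSet i))
    balanced-bag v = decide (any? (λ i → T? (balanced C (bagSet i))))
      where
      decide : Dec (∃[ i ] T (balanced C (bagSet i))) → ∃[ i ] T (balanced C (bagSet i))
      decide (yes p) = p
      decide (no ¬p) = ⊥-elim (not-opposed h next-bag (proj₁ loop) (proj₂ loop))
        where
        h : ∀ i → ∃[ x ] Heavy i x
        h i = heavy i (λ t → ¬p (i , t))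

        next-bag : ∀ i → Next i (proj₁ (h i))
        next-bag i = toward {x = proj₁ (h i)} (proj₂ (h i))

        loop : ∃[ i ] proj₁ (next-bag (proj₁ (next-bag i))) ≡ i
        -- A bag containing `v` gives the node at which the orbit starts.
        loop = acyclic⇒2-periodic tree (proj₂ isTree) (λ i → proj₁ (next-bag i))
          (λ i → proj₁ (proj₂ (next-bag i))) (proj₁ (coversVerts v))

-- Stretch

T-ext : ∀ {a b} → (T a → T b) → (T b → T a) → a ≡ b
T-ext {true}  {true}  f g = refl
T-ext {true}  {false} f g = ⊥-elim (f _)
T-ext {false} {true}  f g = ⊥-elim (g _)
T-ext {false} {false} f g = refl

least : (P : ℕ → Bool) → ∀ k → T (P k) → ∃[ m ] m ≤ k × T (P m) × (∀ j → T (P j) → m ≤ j)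
least P zero    t = 0 , z≤n , t , λ _ _ → z≤n
least P (suc k) t with T? (P 0)
... | yes t₀ = 0 , z≤n , t₀ , λ _ _ → z≤n
... | no ¬t₀ with m , m≤k , tm , min ← least (P ∘ suc) k t =
  suc m , s≤s m≤k , tm , λ { zero t₀ → ⊥-elim (¬t₀ t₀) ; (suc j) tj → s≤s (min j tj) }

-- The distance is the least radius whose disk about `v` contains `u`. A walk of that length, made
-- simple, cannot become shorter and so is the required path.
within⇒distance : (H : Graph n) → ∀ {u v k} → Within (Adj H) u v k → ∃[ d ] Distance H u v d × d ≤ k
within⇒distance H {u} {v} {k} w =
  let m , m≤k , t , min = least (λ k → disk k v u) k (disk⁺ k w)
      w′ , w′≤ = disk⁻ m t
      w″ , un , w″≤ = simplify w′
  in m , ((record { walk = w″ ; distinct = un } ,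
       ≤-antisym (≤-trans w″≤ w′≤) (min _ (disk⁺ _ (w″ , ≤-refl)))) ,
          (λ { j (p , refl) → min _ (disk⁺ _ (walk p , ≤-refl)) })) , m≤k
  where open Growth H

power-of-2-below : ∀ n → ∃[ ℓ ] (2 ^ ℓ ≤ suc n) × (suc n < 2 ^ suc ℓ)
power-of-2-below zero    = 0 , ≤-refl , ≤-refl
power-of-2-below (suc n) with ℓ , le , lt ← power-of-2-below n with m≤n⇒m<n∨m≡n lt
... | inj₁ lt′ = ℓ , m≤n⇒m≤1+n le , lt′
... | inj₂ eq  = suc ℓ , ≤-reflexive (sym eq) ,
  ≤-trans (s≤s (≤-reflexive eq)) (^-monoʳ-< 2 (s≤s (s≤s z≤n)) (n<1+n (suc ℓ)))

-- The integer `k * ℓ` equals log₂ of `(2 ^ ℓ) ^ k`, so taking the floor after multiplying by `k`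
-- loses nothing.
*≤⌊log₂⌋ : ∀ {ℓ n} → 2 ^ ℓ ≤ n → ∀ k → k * ℓ ≤ ⌊ k ·log₂ n ⌋
*≤⌊log₂⌋ {ℓ} {n} le k = begin
  k * ℓ                    ≡⟨ *-comm k ℓ ⟩
  ℓ * k                    ≡⟨ ⌊log₂[2^n]⌋≡n (ℓ * k) ⟨
  ⌊log₂ 2 ^ (ℓ * k) ⌋      ≡⟨ cong ⌊log₂_⌋ (^-*-assoc 2 ℓ k) ⟨
  ⌊log₂ (2 ^ ℓ) ^ k ⌋      ≤⟨ ⌊log₂⌋-mono-≤ (^-monoˡ-≤ k le) ⟩
  ⌊log₂ n ^ k ⌋            ∎
  where open ≤-Reasoning

unique-coded : {A : Set} {m : ℕ} {xs : List A} (R : A → Fin m → Set) → Unique xs →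
               (∀ {x} → x ∈ xs → ∃[ c ] R x c) → (∀ {x y c} → R x c → R y c → x ≡ y) → length xs ≤ m
unique-coded {xs = xs} R un code inj =
  injective⇒≤ {f = λ i → proj₁ (code (∈-lookup {xs = xs} i))} λ {i} {j} eq →
  unique-lookup un (inj (proj₂ (code (∈-lookup {xs = xs} i)))
    (subst (R (lookup xs j)) (sym eq) (proj₂ (code (∈-lookup {xs = xs} j)))))

-- Separators, chosen edges and walks across the levels

module Levels {n : ℕ} (G : Graph n) (connected : Connected G) where

  open Growth G

  walk-between : ∀ u v → Walk G u v
  walk-between u v = walk (connected u v)

  symmetric : ∀ {u v} → Adj G u v → Adj G v u
  symmetric {u} {v} = subst T (Graph.sym G u v)

  loopless : ∀ {u} → ¬ Adj G u u
  loopless {u} a = subst T (Graph.irrefl G u) a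

  module _ {ρ : ℕ} (C : VertexSet n) (v₀ : Fin n) (bal : T (balanced C (disk ρ v₀))) where

    -- Invariant of the widening: all disks share one radius `r`, and either one of them is balanced
    -- or every round so far has widened.
    search : ∀ k → ∃[ r ] r ≤ ρ × iterate k (widen C) singleton ≡ disk r ×
             (T (exists λ v → balanced C (disk r v)) ⊎ r ≡ k)
    search zero = 0 , z≤n , refl , inj₂ refl
    search (suc k) with r , r≤ρ , eq , found ← search k rewrite eq
      with exists (λ v → balanced C (disk r v)) in e
    ... | true  = r , r≤ρ , refl , inj₁ (subst T (sym e) _)
    ... | false with found
    ...   | inj₂ refl = suc r , ≤∧≢⇒< r≤ρ r≢ρ , refl , inj₂ refl
      where
      -- At radius `ρ` the test succeeds at `v₀`, so no widening takes place there.
      r≢ρ : r ≢ ρ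
      r≢ρ refl = subst T e (exists⁺ {S = λ v → balanced C (disk r v)} v₀ bal)

    centre-spec : ∃[ v ] ∃[ r ] r ≤ ρ × centre C ≡ singleton v × separator C ≡ disk r v
      × T (balanced C (disk r v))
    centre-spec with r , r≤ρ , eq , found ← search n rewrite eq
      with choose-spec (λ v → balanced C (disk r v))
    ... | inj₁ (v , t , e) = v , r , r≤ρ , e singleton empty , e (disk r) empty , t
    ... | inj₂ (h , _) with found
    ...   | inj₁ t = let v , p = exists⁻ {S = λ v → balanced C (disk r v)} t in ⊥-elim (h v p)
    -- After n widenings `disk n v₀` contains the balanced `disk ρ v₀` and is therefore balanced
    -- itself.
    ...   | inj₂ refl = ⊥-elim
      (h v₀ (balanced-mono C (λ y t → disk-n {v₀} {y} (proj₁ (disk⁻ ρ {v₀} {y} t))) bal))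

  approaching : ∀ {x v} → x ≢ v → ∀ t → ∃[ m ]
    iterate t (λ S → if grow full S x then S else grow full S) (singleton v) ≡ disk m v ×
    ¬ T (disk m v x) × (T (disk (suc m) v x) ⊎ m ≡ t)
  approaching {x} {v} x≢v zero = 0 , refl , (λ t → x≢v (sym (singleton⁻ {x = v} {x} t))) , inj₂ refl
  approaching {x} {v} x≢v (suc t) with m , eq , x∉ , near ← approaching x≢v t rewrite eq
    with disk (suc m) v x in e
  ... | true  = m , refl , x∉ , inj₁ (subst T (sym e) _)
  ... | false with near
  ...   | inj₂ refl = suc m , refl , subst T e , inj₂ refl

  -- The radius `m` separates `y` from `x` and thereby certifies that the parent is strictly closer
  -- to `v`, without reference to distances.
  parent-spec : ∀ {x v} → x ≢ v →
    ∃[ m ] ∃[ y ] T (parent x (singleton v) y) × T (disk m v y) × Adj G x y × ¬ T (disk m v x)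
  parent-spec {x} {v} x≢v with m , eq , x∉ , near ← approaching x≢v n rewrite eq
    with choose-spec (λ y → disk m v y ∧ adj G y x)
  ... | inj₁ (y , t , e) = let y∈ , a = to (T-∧ {disk m v y}) t in
    m , y , subst (λ S → T (S y)) (sym (e singleton empty)) (singleton⁺ y) , y∈ , symmetric a , x∉
  ... | inj₂ (h , _) = ⊥-elim (none near)
    where
    none : T (disk (suc m) v x) ⊎ m ≡ n → ⊥
    none (inj₂ refl) = x∉ (disk-n (walk-between x v))
    none (inj₁ t) with grow⁻ full (disk m v) t
    ... | inj₁ x∈               = x∉ x∈
    ... | inj₂ (_ , y , y∈ , a) = h y (from (T-∧ {disk m v y}) (y∈ , symmetric a))

  parent-cases : ∀ x s → (∃[ y ] parent x s ≡ singleton y × T (approach x s y) × Adj G y x)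
    ⊎ parent x s ≡ empty
  parent-cases x s with choose-spec (λ y → approach x s y ∧ adj G y x)
  ... | inj₁ (y , t , e) = inj₁ (y , e singleton empty , to (T-∧ {approach x s y}) t)
  ... | inj₂ (_ , e)     = inj₂ (e singleton empty)

  parent⁻ : ∀ x s {y} → T (parent x s y) → T (approach x s y) × Adj G y x
  parent⁻ x s {y} t with parent-cases x s
  ... | inj₁ (z , eq , ap) rewrite eq with refl ← singleton⁻ {x = z} {y} t = ap
  ... | inj₂ eq rewrite eq = ⊥-elim t

  parent-unique : ∀ x s {y z} → T (parent x s y) → T (parent x s z) → y ≡ z
  parent-unique x s {y} {z} t t′ with parent-cases x s
  ... | inj₁ (w , eq , _) rewrite eq = trans (sym (singleton⁻ {x = w} {y} t)) (singleton⁻ {x = w} {z} t′)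
  ... | inj₂ eq rewrite eq = ⊥-elim t

  inside-sym : ∀ {R a b} → Inside R (Adj G) a b → Inside R (Adj G) b a
  inside-sym (a , p , q) = symmetric a , q , p

  inside-end : ∀ {R a b} → Star (Inside R (Adj G)) a b → T (R a) → T (R b)
  inside-end ε Ra = Ra
  inside-end ((_ , _ , Rb) ◅ w) _ = inside-end w Rb

  componentᴺ-≗ : ∀ R x y → componentᴺ R x y ≡ component R x y
  componentᴺ-≗ R x = lookup∘tabulate (component R x)

  component-⊆ : ∀ {R x z} → Star (Inside R (Adj G)) x z → component R x ⊆ component R z
  component-⊆ {R} {x} {z} w y t = let Rx , _ , w′ = component⁻ R {x} t
                                  in component⁺ R {z} (inside-end w Rx) (w′ ◅◅ w)

  componentᴺ-≡ : ∀ {R x z} → Star (Inside R (Adj G)) x z → componentᴺ R x ≡ componentᴺ R z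
  componentᴺ-≡ {R} {x} {z} w = cong Vec.lookup (tabulateᵛ-cong λ y →
    T-ext (component-⊆ {R} {x} {z} w y) (component-⊆ {R} {z} {x} (reverseStar inside-sym w) y))

  next⁻ : ∀ {R x} → T (next R x) → T (R x) × ¬ T (separator (componentᴺ R x) x)
  next⁻ {R} {x} t = let p , q = to (T-∧ {R x}) t in p , not⁻ q

  -- Along a walk in `next R` all vertices have the same normalized component in `R`, hence the same
  -- separator. Each of them escaped its own separator and so escaped that of `x`.
  next-separated : ∀ R x → component (next R) x ⊆ component (componentᴺ R x ∖ separator (componentᴺ R x)) x
  next-separated R x y t = let Nx , Ny , w = component⁻ (next R) {x} t
                           in component⁺ (C ∖ separator C) (member ε Nx) (go w Nx)
    where
    C = componentᴺ R x

    forget : ∀ {a b} → Star (Inside (next R) (Adj G)) a b → Star (Inside R (Adj G)) a b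
    forget = gmap id λ (a , p , q) → a , proj₁ (next⁻ {R} p) , proj₁ (next⁻ {R} q)

    member : ∀ {z} → Star (Inside (next R) (Adj G)) z x → T (next R z) → T ((C ∖ separator C) z)
    member {z} w Nz = from (T-∧ {C z})
      (subst T (sym (componentᴺ-≗ R x z))
        (component⁺ R {x} (inside-end (forget w) (proj₁ (next⁻ {R} Nz))) (forget w)) ,
      not⁺ (subst (λ C → ¬ T (separator C z)) (componentᴺ-≡ (forget w)) (proj₂ (next⁻ {R} Nz))))

    go : ∀ {z} → Star (Inside (next R) (Adj G)) z x → T (next R x) →
      Star (Inside (C ∖ separator C) (Adj G)) z x
    go ε _ = ε
    go {z} (_◅_ {j = z′} (a , p , q) w) Nx = (a , member ((a , p , q) ◅ w) p , member w q) ◅ go w Nx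

  parentEdges⁻ : ∀ R {x y} → T (parentEdges R x y) → T (R x) × T (parent x (centre (componentᴺ R x)) y)
  parentEdges⁻ R {x} = to (T-∧ {R x})

  parentEdges-unique : ∀ R {x y z} → T (parentEdges R x y) → T (parentEdges R x z) → y ≡ z
  parentEdges-unique R {x} t t′ =
    parent-unique x (centre (componentᴺ R x)) (proj₂ (parentEdges⁻ R t)) (proj₂ (parentEdges⁻ R t′))

  chosen⁻ : ∀ k {x y} → T (chosen k x y) → ∃[ j ] j < k × T (parentEdges (remaining j) x y)
  chosen⁻ (suc k) {x} {y} t with to (T-∨ {chosen k x y}) t
  ... | inj₁ t′ = let j , j<k , p = chosen⁻ k t′ in j , m≤n⇒m≤1+n j<k , p
  ... | inj₂ p  = k , ≤-refl , p

  chosen⁺ : ∀ {j k x y} → j < k → T (parentEdges (remaining j) x y) → T (chosen k x y)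
  chosen⁺ {j} {suc k} {x} {y} (s≤s j≤k) t with m≤n⇒m<n∨m≡n j≤k
  ... | inj₁ j<k  = from (T-∨ {chosen k x y}) (inj₁ (chosen⁺ j<k t))
  ... | inj₂ refl = from (T-∨ {chosen k x y}) (inj₂ t)

  chosen-adj : ∀ {x y} → T (chosen n x y) → Adj G x y
  chosen-adj {x} t = let j , _ , p = chosen⁻ n t in
    symmetric (proj₂ (parent⁻ x (centre (componentᴺ (remaining j) x))
      (proj₂ (parentEdges⁻ (remaining j) p))))

  spannerGraph : Graph n
  spannerGraph = record
    { adj    = spanner
    ; sym    = λ u v → ∨-comm (chosen n u v) (chosen n v u)
    ; irrefl = λ u → T-ext {spanner u u} {false} (λ t → loop u (to (T-∨ {chosen n u u}) t)) (λ ())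
    }
    where
    loop : ∀ u → T (chosen n u u) ⊎ T (chosen n u u) → ⊥
    loop u (inj₁ t) = loopless (chosen-adj t)
    loop u (inj₂ t) = loopless (chosen-adj t)

  spanner-⊆ : SpanningSubgraph spannerGraph G
  spanner-⊆ u v t with to (T-∨ {chosen n u v}) t
  ... | inj₁ t′ = chosen-adj t′
  ... | inj₂ t′ = symmetric (chosen-adj t′)

  H = Adj spannerGraph

  H-sym : ∀ {u v} → H u v → H v u
  H-sym {u} {v} = subst T (Graph.sym spannerGraph u v)

  disk-< : ∀ {k m v a} → T (disk k v a) → ¬ T (disk m v a) → m < k
  disk-< {k} {m} {v} {a} a∈ a∉ with k ≤? m
  ... | yes k≤m = ⊥-elim (a∉ (grows-mono full (singleton v) k≤m a a∈))
  ... | no  k≰m = ≰⇒> k≰m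

  -- The walk is examined from its end `b`; the vertex `y` is the last one outside `R`.
  leave : ∀ R {a b} (w : Walk G a b) → T (R b) → (T (R a) × Star (Inside R (Adj G)) a b) ⊎
          (∃[ y ] ¬ T (R y) × ∃[ k ] ∃[ l ] Within (Adj G) a y k × Within (Adj G) y b l × k + l ≤ ∣ w ∣ʷ)
  leave R ε Rb = inj₁ (Rb , ε)
  leave R {a} (r ◅ w) Rb with leave R w Rb
  ... | inj₂ (y , y∉ , k , l , p , q , le) =
    inj₂ (y , y∉ , suc k , l , within-trans (r ◅ ε , s≤s z≤n) p , q , s≤s le)
  ... | inj₁ (Rz , w′) with T? (R a)
  ...   | yes Ra = inj₁ (Ra , (r , Ra , Rz) ◅ w′)
  ...   | no  a∉ = inj₂ (a , a∉ , 0 , suc ∣ w ∣ʷ , (ε , z≤n) , (r ◅ w , ≤-refl) , ≤-refl)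

  module _ {j : ℕ} (j<n : j < n) (x₀ v : Fin n)
    (centre≡ : centre (componentᴺ (remaining j) x₀) ≡ singleton v) where

    private R = remaining j

    -- The chosen edges lead from `a` to `b` in `p` steps; from there `v` is `q` steps away in the
    -- whole graph. The descent ends at the centre or on leaving the level.
    Exit : ℕ → Fin n → Set
    Exit k a = ∃[ b ] ∃[ p ] ∃[ q ] Within H a b p × Within (Adj G) b v q × p + q ≤ k × (b ≡ v ⊎ ¬ T (R b))

    parent-edge : ∀ {a y} → T (R a) → componentᴺ R a ≡ componentᴺ R x₀ →
      T (parent a (singleton v) y) → H a y
    parent-edge {a} {y} Ra same par = from T-∨ (inj₁ (chosen⁺ j<n (from (T-∧ {R a}) (Ra ,
      subst (λ s → T (parent a s y)) (sym (trans (cong centre same) centre≡)) par))))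

    -- Each parent is strictly closer to `v`, so a step along a chosen edge uses up one unit of `k`.
    -- The assumption `same` is conditional because a parent may already lie outside `R`.
    descend : ∀ k a → T (disk k v a) → (T (R a) → componentᴺ R a ≡ componentᴺ R x₀) → Exit k a
    descend zero a a∈ same = a , 0 , 0 , (ε , z≤n) , disk⁻ 0 a∈ , z≤n ,
      inj₁ (sym (singleton⁻ {x = v} {a} a∈))
    descend (suc k) a a∈ same = decide (a ≟ v) (T? (R a))
      where
      decide : Dec (a ≡ v) → Dec (T (R a)) → Exit (suc k) a
      decide (yes refl) _       = a , 0 , 0 , (ε , z≤n) , (ε , z≤n) , z≤n , inj₁ refl
      decide (no _)     (no a∉) = a , 0 , suc k , (ε , z≤n) , disk⁻ (suc k) a∈ , ≤-refl , inj₂ a∉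
      decide (no a≢v)   (yes Ra) =
        let m , y , par , y∈ , ay , a∉ = parent-spec a≢v
            b , p , q , w , w′ , le , end =
              descend k y (grows-mono full (singleton v) (≤-pred (disk-< {suc k} {m} {v} {a} a∈ a∉)) y y∈)
              -- A parent in `R` is adjacent to `a` in `R`, hence in the same component and with the
              -- same centre.
              (λ Ry → trans (componentᴺ-≡ {R} {y} {a} ((symmetric ay , Ry , Ra) ◅ ε)) (same Ra))
        in b , suc p , q , within-trans (parent-edge Ra (same Ra) par ◅ ε , s≤s z≤n) w , w′ , s≤s le , end

  module _ (ρ : ℕ) (balanced-disk : ∀ C → ∃[ v ] T (balanced C (disk ρ v))) where

    centreᴳ : ∀ C → ∃[ v ] ∃[ r ] r ≤ ρ × centre C ≡ singleton v × separator C ≡ disk r v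
      × T (balanced C (disk r v))
    centreᴳ C = centre-spec C (proj₁ (balanced-disk C)) (proj₂ (balanced-disk C))

    -- Every level halves the bound on component sizes; the multiplicative form avoids division.
    halving : ∀ k x → 2 ^ k * count (component (remaining k) x) ≤ n
    halving zero    x = subst (_≤ n) (sym (*-identityˡ (count (component full x))))
      (count≤ (component full x))
    halving (suc k) x = begin
      2 * 2 ^ k * count (component (next R) x)
        ≡⟨ cong (_* count (component (next R) x)) (*-comm 2 (2 ^ k)) ⟩
      2 ^ k * 2 * count (component (next R) x)   ≡⟨ *-assoc (2 ^ k) 2 _ ⟩
      2 ^ k * (2 * count (component (next R) x))
        ≤⟨ *-monoʳ-≤ (2 ^ k) (*-monoʳ-≤ 2 (count-mono (next-separated R x))) ⟩
      2 ^ k * (2 * count (component (C ∖ separator C) x))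
        ≤⟨ *-monoʳ-≤ (2 ^ k) (balanced⁻ C (separator C) separator-balanced x) ⟩
      2 ^ k * count C
        ≤⟨ *-monoʳ-≤ (2 ^ k) (count-mono {S = C} {component R x} λ y → subst T (componentᴺ-≗ R x y)) ⟩
      2 ^ k * count (component R x)              ≤⟨ halving k x ⟩
      n                                          ∎
      where
      open ≤-Reasoning
      R = remaining k
      C = componentᴺ R x

      separator-balanced : T (balanced C (separator C))
      separator-balanced = let _ , _ , _ , _ , sep , bal = centreᴳ C
                           in subst (λ S → T (balanced C S)) (sym sep) bal

    -- Here `outer` is the induction hypothesis with error `e`. The detour from `a` over `z` to `v`
    -- and back to `b` adds `2 * r` to `k + l`. Its outer parts use chosen edges; if either descent
    -- stops outside the level, the middle part over `v` was cut earlier and `outer` replaces it.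
    meet : ∀ j → j < n → (e : ℕ) →
      (∀ {a b z k l} → ¬ T (remaining j z) → Within (Adj G) a z k → Within (Adj G) z b l →
        Within H a b (k + l + e)) →
      ∀ {a b z k l} → T (remaining j z) → ¬ T (remaining (suc j) z) →
      Star (Inside (remaining j) (Adj G)) a z → Star (Inside (remaining j) (Adj G)) b z →
      Within (Adj G) a z k → Within (Adj G) b z l → Within H a b (k + l + (2 * ρ + e))
    meet j j<n e outer {a} {b} {z} {k} {l} Rz z∉ wa wb pa pb =
      let v , r , r≤ρ , centre≡ , sep≡ , _ = centreᴳ (componentᴺ (remaining j) z)
          -- As `z` vanishes at level `j`, it lies in the separator of its component.
          z→v = disk⁻ r {v} {z} (subst (λ S → T (S z)) sep≡ (separated (T? _)))
      in within-relax (≤-trans (≤-reflexive (rearrange k l r))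
           (+-monoʳ-≤ (k + l) (+-monoˡ-≤ e (*-monoʳ-≤ 2 r≤ρ))))
           (join v (descend j<n z v centre≡ (k + r) a (disk⁺ (k + r) (within-trans pa z→v))
             (λ _ → componentᴺ-≡ {remaining j} {a} {z} wa))
                   (descend j<n z v centre≡ (l + r) b (disk⁺ (l + r) (within-trans pb z→v))
                     (λ _ → componentᴺ-≡ {remaining j} {b} {z} wb)))
      where
      open +-*-Solver using (solve; _:+_; _:*_; con; _:=_)

      separated : Dec (T (separator (componentᴺ (remaining j) z) z)) →
        T (separator (componentᴺ (remaining j) z) z)
      separated (yes t) = t
      separated (no ¬t) = ⊥-elim (z∉ (from (T-∧ {remaining j z}) (Rz , not⁺ ¬t)))

      rearrange : ∀ k l r → k + r + (l + r) + e ≡ k + l + (2 * r + e)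
      rearrange k l r = solve 4
        (λ k l r e → k :+ r :+ (l :+ r) :+ e := k :+ l :+ (con 2 :* r :+ e)) refl k l r e

      rearrange′ : ∀ p q p′ q′ → p + (q + q′ + e) + p′ ≡ p + q + (p′ + q′) + e
      rearrange′ p q p′ q′ = solve 5
        (λ p q p′ q′ e → p :+ (q :+ q′ :+ e) :+ p′ := p :+ q :+ (p′ :+ q′) :+ e) refl p q p′ q′ e

      join : ∀ v {i i′} →
        ∃[ b ] ∃[ p ] ∃[ q ] Within H a b p × Within (Adj G) b v q × p + q ≤ i
          × (b ≡ v ⊎ ¬ T (remaining j b)) →
        ∃[ c ] ∃[ p ] ∃[ q ] Within H b c p × Within (Adj G) c v q × p + q ≤ i′
          × (c ≡ v ⊎ ¬ T (remaining j c)) →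
        Within H a b (i + i′ + e)
      join v {i} {i′} (a′ , p , q , aa′ , a′v , le , end) (b′ , p′ , q′ , bb′ , b′v , le′ , end′) =
        go end end′
        where
        through : Within H a′ b′ (q + q′ + e) → Within H a b (i + i′ + e)
        through w = within-relax (≤-trans (≤-reflexive (rearrange′ p q p′ q′))
          (+-monoˡ-≤ e (+-mono-≤ le le′)))
          (within-trans (within-trans aa′ w) (within-sym H-sym bb′))

        go : a′ ≡ v ⊎ ¬ T (remaining j a′) → b′ ≡ v ⊎ ¬ T (remaining j b′) → Within H a b (i + i′ + e)
        go (inj₁ refl) (inj₁ refl) = through (ε , z≤n)
        -- The end `a′` itself is the vertex at which the middle walk was cut.
        go (inj₂ a′∉) _ = through
          (outer {k = 0} a′∉ (ε , z≤n) (within-trans a′v (within-sym symmetric b′v)))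
        go (inj₁ _) (inj₂ b′∉) = through
          (within-relax (≤-reflexive (cong (_+ e) (+-identityʳ (q + q′))))
            (outer b′∉ (within-trans a′v (within-sym symmetric b′v)) (ε , z≤n)))

    -- Induction on the level by which some vertex `z` of the walk has been removed. At level 0
    -- there is none. Otherwise either a vertex of the walk was removed earlier, or both halves
    -- survive in one component until `z` is removed, and `meet` pays `2 * ρ` for this level.
    stretch : ∀ j → j ≤ n → ∀ {a b z k l} → ¬ T (remaining j z) → Within (Adj G) a z k →
      Within (Adj G) z b l →
              Within H a b (k + l + 2 * ρ * j)
    stretch zero    _   z∉ _ _ = ⊥-elim (z∉ _)
    stretch (suc j) j<n {a} {b} {z} {k} {l} z∉ p q = decide (T? (remaining j z))
      where
      open ≤-Reasoning
      R = remaining j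
      q′ = within-sym symmetric q

      E≤ : 2 * ρ * j ≤ 2 * ρ * suc j
      E≤ = *-monoʳ-≤ (2 * ρ) (n≤1+n j)

      decide : Dec (T (R z)) → Within H a b (k + l + 2 * ρ * suc j)
      decide (no z∉′) = within-relax (+-monoʳ-≤ (k + l) E≤) (stretch j (<⇒≤ j<n) z∉′ p q)
      decide (yes Rz) with leave R (proj₁ p) Rz | leave R (proj₁ q′) Rz
      ... | inj₂ (y , y∉ , k₁ , k₂ , ay , yz , le) | _ =
        within-relax (begin
          k₁ + (k₂ + l) + 2 * ρ * j ≡⟨ cong (_+ 2 * ρ * j) (+-assoc k₁ k₂ l) ⟨
          k₁ + k₂ + l + 2 * ρ * j   ≤⟨ +-mono-≤ (+-monoˡ-≤ l (≤-trans le (proj₂ p))) E≤ ⟩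
          k + l + 2 * ρ * suc j     ∎)
          (stretch j (<⇒≤ j<n) y∉ ay (within-trans yz q))
      ... | inj₁ _ | inj₂ (y , y∉ , k₁ , k₂ , by , yz , le) =
        within-relax (begin
          k + k₂ + k₁ + 2 * ρ * j
            ≡⟨ cong (_+ 2 * ρ * j) (trans (+-assoc k k₂ k₁) (cong (k +_) (+-comm k₂ k₁))) ⟩
          k + (k₁ + k₂) + 2 * ρ * j ≤⟨ +-mono-≤ (+-monoʳ-≤ k (≤-trans le (proj₂ q′))) E≤ ⟩
          k + l + 2 * ρ * suc j     ∎)
          (stretch j (<⇒≤ j<n) y∉ (within-trans p (within-sym symmetric yz)) (within-sym symmetric by))
      ... | inj₁ (_ , wa) | inj₁ (_ , wb) =
        within-relax (≤-reflexive (cong (k + l +_) (sym (*-suc (2 * ρ) j))))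
          (meet j j<n (2 * ρ * j) (stretch j (<⇒≤ j<n)) Rz z∉ wa wb p q′)

-- Number of edges

count-member : {S : VertexSet n} (x : Fin n) → T (S x) → 1 ≤ count S
count-member {S = S} x Sx = ≤-trans (s≤s z≤n) (count-strict {S = empty} {S} (λ _ ()) x Sx λ ())

-- An edge is charged to the level and the endpoint that chose it.
module Charging {ℓ n : ℕ} (E : Fin ℓ → Fin n → Fin n → Set)
  (functional : ∀ j {x y z} → E j x y → E j x z → y ≡ z) where

  Charge : Fin n × Fin n → Fin (ℓ * n) → Set
  Charge (u , v) c = toℕ u < toℕ v × ∃[ j ] ∃[ x ] c ≡ combine {ℓ} {n} j x
    × ((x ≡ u × E j u v) ⊎ (x ≡ v × E j v u))

  charge-injective : ∀ {e e′ c} → Charge e c → Charge e′ c → e ≡ e′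
  charge-injective (lt , j , x , eq , s) (lt′ , j′ , x′ , eq′ , s′)
    with refl , refl ← combine-injective j x j′ x′ (trans (sym eq) eq′) with s | s′
  ... | inj₁ (refl , p) | inj₁ (refl , q) = cong (x ,_) (functional j p q)
  ... | inj₂ (refl , p) | inj₂ (refl , q) = cong (_, x) (functional j p q)
  -- One vertex choosing the same edge in both orientations contradicts the order imposed on the
  -- endpoints.
  ... | inj₁ (refl , p) | inj₂ (refl , q) with refl ← functional j p q = contradiction lt′ (<-asym lt)
  ... | inj₂ (refl , p) | inj₁ (refl , q) with refl ← functional j p q = contradiction lt′ (<-asym lt)

module Sparse {n : ℕ} (G : Graph n) (connected : Connected G)
  (ρ : ℕ) (balanced-disk : ∀ C → ∃[ v ] T (Growth.balanced G C (Growth.disk G ρ v))) where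

  open Growth G
  open Levels G connected

  -- A vertex that is its own centre can only take its parent from its own singleton, which
  -- looplessness forbids.
  approach-self : ∀ x → approach x (singleton x) ≡ singleton x
  approach-self x = go n
    where
    go : ∀ t → iterate t (λ S → if grow full S x then S else grow full S) (singleton x) ≡ singleton x
    go zero = refl
    go (suc t) rewrite go t with grow full (singleton x) x | grow-⊇ full (singleton x) x (singleton⁺ x)
    ... | true | _ = refl

  module _ {j : ℕ} (n<2^ : n < 2 ^ suc j) where

    private R = remaining j

    -- By `halving`, `2 ^ j` times the size is at most n, hence less than twice `2 ^ j`.
    component-small : ∀ x → count (component R x) ≤ 1
    component-small x = ≤-pred (*-cancelˡ-< (2 ^ j) _ 2 (≤-trans (s≤s (halving ρ balanced-disk j x))
      (≤-trans n<2^ (≤-reflexive (*-comm 2 (2 ^ j))))))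

    module _ {x : Fin n} (Rx : T (R x)) where

      private C = componentᴺ R x

      count-C : count C ≤ 1
      count-C = ≤-trans (count-mono {S = C} {component R x} λ y → subst T (componentᴺ-≗ R x y))
        (component-small x)

      x∈C : T (C x)
      x∈C = subst T (sym (componentᴺ-≗ R x x)) (component⁺ R {x} Rx ε)

      only-x : ∀ {y} → T (C y) → x ≡ y
      only-x {y} y∈C = decide (x ≟ y)
        where
        decide : Dec (x ≡ y) → x ≡ y
        decide (yes eq) = eq
        decide (no x≢y) = contradiction (count-pair {S = C} x y x∈C y∈C x≢y) (<⇒≱ (s≤s count-C))

      self-balanced : T (balanced C (disk 0 x))
      self-balanced = balanced⁺ C (singleton x) λ w → ≤-trans (*-monoʳ-≤ 2 (none w)) z≤n
        where
        none : ∀ w → count (component (C ∖ singleton x) w) ≤ 0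
        none w = ≮⇒≥ λ lt →
          let z , t = count-positive {S = component (C ∖ singleton x) w} lt
              _ , z∈ , _ = component⁻ (C ∖ singleton x) {w} t
              Cz , z∉ = to (T-∧ {C z}) z∈
          in not⁻ z∉ (subst (T ∘ singleton x) (only-x Cz) (singleton⁺ x))

      -- The least balanced radius is 0, by `self-balanced`. A centre other than `x` would leave `x`
      -- as a component of size 1, more than half of `C`.
      centre-self : centre C ≡ singleton x
      centre-self = check (centre-spec C x self-balanced)
        where
        check : ∃[ v ] ∃[ r ] r ≤ 0 × centre C ≡ singleton v × separator C ≡ disk r v
          × T (balanced C (disk r v)) →
                centre C ≡ singleton x
        check (v , zero , _ , eq , _ , bal) = decide (x ≟ v)
          where
          decide : Dec (x ≡ v) → centre C ≡ singleton x
          decide (yes refl) = eq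
          decide (no x≢v) = contradiction
            (≤-trans (≤-trans (*-monoʳ-≤ 2 (count-member {S = component (C ∖ singleton v) x} x
                       (component⁺ (C ∖ singleton v) {x}
                         (from (T-∧ {C x}) (x∈C , not⁺ (x≢v ∘ sym ∘ singleton⁻ {x = v} {x}))) ε)))
                     (balanced⁻ C (singleton v) bal x)) count-C)
            λ { (s≤s ()) }

      no-parent : ∀ {y} → ¬ T (parent x (centre C) y)
      no-parent {y} t =
        let a , yx = parent⁻ x (singleton x) (subst (λ s → T (parent x s y)) centre-self t)
        in loopless (subst (λ z → Adj G z x)
             (sym (singleton⁻ {x = x} {y} (subst (λ S → T (S y)) (approach-self x) a))) yx)

    no-edges : ∀ {x y} → ¬ T (parentEdges R x y)
    no-edges {x} t = let Rx , p = parentEdges⁻ R t in no-parent Rx p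

  module _ {ℓ : ℕ} (n<2^ : n < 2 ^ suc ℓ) where

    chosen-level : ∀ {x y} → T (chosen n x y) → ∃[ j ] T (parentEdges (remaining (toℕ {ℓ} j)) x y)
    chosen-level {x} {y} t = let j , _ , p = chosen⁻ n t in decide j p (j <? ℓ)
      where
      decide : ∀ j → T (parentEdges (remaining j) x y) → Dec (j < ℓ) →
        ∃[ j ] T (parentEdges (remaining (toℕ {ℓ} j)) x y)
      decide j p (yes lt) = fromℕ< lt ,
        subst (λ j → T (parentEdges (remaining j) x y)) (sym (toℕ-fromℕ< lt)) p
      decide j p (no  ≮ℓ) = ⊥-elim (no-edges {j = j} (≤-trans n<2^ (^-monoʳ-≤ 2 (s≤s (≮⇒≥ ≮ℓ)))) p)

    open Charging {ℓ} {n} (λ j x y → T (parentEdges (remaining (toℕ j)) x y))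
      (λ j → parentEdges-unique (remaining (toℕ j)))

    sparse : length (edges spannerGraph) ≤ ℓ * n
    sparse = unique-coded Charge (filter⁺ (T? ∘ isEdge) (cartesianProduct⁺ (allFin⁺ n) (allFin⁺ n)))
      (λ {e} e∈ → charge e (proj₂
        (∈-filter⁻ (T? ∘ isEdge) {xs = cartesianProduct (allFin n) (allFin n)} e∈))) charge-injective
      where
      isEdge : Fin n × Fin n → Bool
      isEdge = uncurry λ u v → (toℕ u <ᵇ toℕ v) ∧ spanner u v

      charge : ∀ e → T (isEdge e) → ∃[ c ] Charge e c
      charge (u , v) t = let lt , h = to (T-∧ {toℕ u <ᵇ toℕ v}) t
                         in decide (<ᵇ⇒< _ _ lt) (to (T-∨ {chosen n u v}) h)
        where
        decide : toℕ u < toℕ v → T (chosen n u v) ⊎ T (chosen n v u) → ∃[ c ] Charge (u , v) c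
        decide lt (inj₁ p) = let j , q = chosen-level p in combine j u , lt , j , u , refl , inj₁ (refl , q)
        decide lt (inj₂ p) = let j , q = chosen-level p in combine j v , lt , j , v , refl , inj₂ (refl , q)

    -- A walk that meets a vertex removed before level `ℓ` is handled by `stretch`. Any other walk
    -- stays in one component of `remaining ℓ`, which is a single vertex, so its ends coincide.
    spanner-within : ℓ ≤ n → ∀ {u v d} → Within (Adj G) u v d → Within H u v (d + 2 * ρ * ℓ)
    spanner-within ℓ≤n {u} {v} {d} (w , w≤) = decide (T? (remaining ℓ v))
      where
      R = remaining ℓ

      decide : Dec (T (R v)) → Within H u v (d + 2 * ρ * ℓ)
      decide (no v∉) = within-relax (≤-reflexive (cong (_+ 2 * ρ * ℓ) (+-identityʳ d)))
        (stretch ρ balanced-disk ℓ ℓ≤n v∉ (w , w≤) (ε , z≤n))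
      decide (yes Rv) with leave R w Rv
      ... | inj₂ (y , y∉ , k , l , p , q , le) =
        within-relax (+-monoˡ-≤ (2 * ρ * ℓ) (≤-trans le w≤)) (stretch ρ balanced-disk ℓ ℓ≤n y∉ p q)
      ... | inj₁ (_ , w′) =
        subst (λ u → Within H u v _)
          (only-x {j = ℓ} n<2^ Rv (subst T (sym (componentᴺ-≗ R v u)) (component⁺ R {v} Rv w′))) (ε , z≤n)

-- From tree-breadth to the constructed spanner

module _ {n : ℕ} {G : Graph n} (connected : Connected G) {ρ tb : ℕ} (isTb : TreeBreadth G tb)
  (tb≤ρ : tb ≤ ρ) where

  open Growth G

  -- A balanced bag lies in a disk of radius `tb`, hence in one of radius `ρ`, and enlarging the
  -- removed set preserves balance.
  balanced-disk : Fin n → ∀ C → ∃[ v ] T (balanced C (disk ρ v))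
  balanced-disk v₀ C = 
    let (D , breadth , _) , _ = isTb
        i , bal = balanced-bag D C v₀
        v , bag⊆ = breadth i
    in v , balanced-mono C (λ y y∈ → in-disk v y (bag⊆ y (bagSet⁻ D y∈))) bal
    where
    in-disk : ∀ v y → Disk tb v G y → T (disk ρ v y)
    in-disk v y (d , ((p , refl) , _) , d≤) = disk⁺ ρ (walk p , ≤-trans d≤ tb≤ρ)

sparseSpanner : ∀ {n} (G : Graph (suc n)) (connected : Connected G) {ρ tb} → TreeBreadth G tb → tb ≤ ρ →
                SparseSpanner ρ G (Levels.spannerGraph G connected)
sparseSpanner {n} G connected {ρ} isTb tb≤ρ =
  let ℓ , 2^≤ , <2^ = power-of-2-below n
      -- The `ℓ` levels that matter are among the levels actually run.
      ℓ≤ = ≤-trans (m≤n^m ℓ) 2^≤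
  in (Levels.spanner-⊆ G connected , λ u v d ((p , eq) , _) →
       let d′ , D , d′≤ = within⇒distance (Levels.spannerGraph G connected)
             (Sparse.spanner-within G connected ρ bal <2^ ℓ≤ (walk p , ≤-reflexive eq))
       in d′ , D , ≤-trans d′≤ (+-monoʳ-≤ d (*≤⌊log₂⌋ 2^≤ (2 * ρ)))) ,
     ≤-trans (Sparse.sparse G connected ρ bal {ℓ} <2^)
       (≤-trans (≤-reflexive (*-comm ℓ (suc n))) (*≤⌊log₂⌋ 2^≤ (suc n)))
  where
  bal = balanced-disk connected isTb tb≤ρ zero

  m≤n^m : ∀ m → m ≤ 2 ^ m
  m≤n^m m = <⇒≤ (go m)
    where
    go : ∀ m → m < 2 ^ m
    go zero    = s≤s z≤n
    go (suc m) = ≤-trans (+-mono-≤ (≤-trans (s≤s z≤n) (go m)) (go m))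
      (+-monoʳ-≤ (2 ^ m) (≤-reflexive (sym (+-identityʳ (2 ^ m)))))

-- The adjacency matrix is the entire input: the search for least balanced radii takes the place of
-- `ρ` and of a tree-decomposition, so one program serves all values of `ρ`.
spannerProgram : env {matrix} {Graph} (λ n → adjacencyMatrix) ∋ᵐ λ n G → Spanner.spanner (adj G)
spannerProgram = spannerᶜ {A = λ n G → adj G} (inputᶜ {env {matrix} {Graph} (λ n → adjacencyMatrix)})

theorem2 : (∀ n .{{_ : NonZero n}} (G : Graph n) (ρ tb : ℕ) →
    Connected G → TreeBreadth G tb → tb ≤ ρ →
    ∃[ H ] SparseSpanner ρ G H)
    ×
    (∃[ p ] ∃[ c ] ∃[ k ]
    (∀ n .{{_ : NonZero n}} (G : Graph n) (ρ tb : ℕ) →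
    Connected G → TreeBreadth G tb → tb ≤ ρ →
    ∃[ H ] ∃[ t ]
    SparseSpanner ρ G H ×
    (_·_⇓_#_ {matrix} {matrix} p (adjacencyMatrix G) (adjacencyMatrix H) t) ×
    t ≤ c * n ^ k))
theorem2 =
  (λ n G ρ tb c b b≤ → let H , _ , s , _ = construct n G ρ tb c b b≤ in H , s) ,
  prog spannerProgram , proj₁ bounded , proj₁ (proj₂ bounded) , construct
  where
  bounded = eval-bounded (bound spannerProgram)

  construct : ∀ n .{{_ : NonZero n}} (G : Graph n) (ρ tb : ℕ) → Connected G → TreeBreadth G tb → tb ≤ ρ →
    ∃[ H ] ∃[ t ] SparseSpanner ρ G H
      × (_·_⇓_#_ {matrix} {matrix} (prog spannerProgram) (adjacencyMatrix G) (adjacencyMatrix H) t) ×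
    t ≤ proj₁ bounded * n ^ proj₁ (proj₂ bounded)
  construct zero    _ _ _ _ _ _ = ⊥-elim (≢-nonZero⁻¹ 0 refl)
  construct (suc n) G ρ tb connected isTb tb≤ρ =
    let t , r , t≤ = run spannerProgram (suc n) G
    in Levels.spannerGraph G connected , t , sparseSpanner G connected isTb tb≤ρ , r ,
         ≤-trans t≤ (proj₂ (proj₂ bounded) (suc n))
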